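{- Let $n$ be a positive integer. The flow polynomial of the complete graph $K_n$ satisfies $$F_{K_n}(x)=\frac{(-1)^{\frac12 n(n-1)}}{x^n}\left.\left(\frac{\partial^n}{\partial z^n}\Bigl\{\sum_{i=0}^n\frac{z^i}{i!}(1-x)^{\frac12 i(i-1)}\Bigr\}^x\right)\right|_{z=0}.$$
   Context: The flow polynomial $F_G$ of a graph $G=(V,E)$ is the polynomial such that, for every positive integer $q$, $F_G(q)$ is the number of nowhere-zero flows with values in $\mathbb{Z}_q=\mathbb{Z}/q\mathbb{Z}$: after fixing any orientation of the edges, these are the assignments of a nonzero element $k_e\in\mathbb{Z}_q$ to each edge $e$ such that at every vertex the sum of $k_e$ over incoming edges equals the sum over outgoing edges. Equivalently, $F_G$ is the characteristic polynomial $\chi_{M}(x)=\sum_{A\subseteq E}(-1)^{|A|}x^{r_M(E)-r_M(A)}$ of the dual $M=M_G^*$ of the graphic matroid $M_G$ of $G$. The expression $\{\cdot\}^x$ is the $x$-th power of a polynomial in $z$ with constant term $1$, understood as the formal power series $\{1+h(z)\}^x=\sum_{j\ge0}\frac{x(x-1)\cdots(x-j+1)}{j!}h(z)^j$ (equivalently, for real $x\ne 0$, the usual real power for $z$ near $0$). The conventions $(1-x)^0=1$ and $z^0=1$ are used. -}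

module Defs where

open import Algebra.Bundles.Raw using (RawRing)
open import Data.Fin using (Fin; toℕ; _<?_; _≟_)
open import Data.Fin.Properties using (all?)
open import Data.Integer using (+_)
open import Data.List using (List; []; _∷_; allFin; cartesianProduct; cartesianProductWith; filter; foldr; length; lookup; map)
open import Data.Nat as ℕ using (ℕ; zero; suc; NonZero; _∸_; _!; _%_)
open import Data.Nat.ListAction using () renaming (sum to sumℕ)
open import Data.Nat.Properties using (_!≢0)
open import Data.Product using (_×_; _,_; proj₁; proj₂)
open import Data.Rational as ℚ using (ℚ; 0ℚ; 1ℚ; _/_)
open import Data.Vec as Vec using (Vec; []; _∷_)
open import Level using (0ℓ)
open import Relation.Binary.PropositionalEquality using (_≡_; _≢_)
open import Relation.Nullary using (Dec; yes; no; ¬?; _×-dec_)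

------------------------------------------------------------------------
-- Graphs and nowhere-zero flows

-- Finite multigraphs.  An edge is listed as (source , target); the order
-- of this pair is the orientation used to define flows.
record Graph : Set where
  constructor graph
  field
    vertices : ℕ
    edges    : List (Fin vertices × Fin vertices)

  #edges : ℕ
  #edges = length edges

  src tgt : Fin #edges → Fin vertices
  src e = proj₁ (lookup edges e)
  tgt e = proj₂ (lookup edges e)

complete : ℕ → Graph
complete n = graph n
  (filter (λ (i , j) → i <? j) (cartesianProduct (allFin n) (allFin n)))

δ : ∀ {n} → Fin n → Fin n → ℕ
δ u v with u ≟ v
... | yes _ = 1
... | no  _ = 0

module _ (G : Graph) (q : ℕ) .{{_ : NonZero q}} where
  open Graph G

  inflow outflow : Vec (Fin q) #edges → Fin vertices → ℕ
  inflow  k v = sumℕ (map (λ e → δ (tgt e) v ℕ.* toℕ (Vec.lookup k e)) (allFin #edges))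
  outflow k v = sumℕ (map (λ e → δ (src e) v ℕ.* toℕ (Vec.lookup k e)) (allFin #edges))

  -- ℤ/qℤ is represented by its residues 0 , … , q - 1.
  IsNowhereZeroFlow : Vec (Fin q) #edges → Set
  IsNowhereZeroFlow k =
    (∀ e → toℕ (Vec.lookup k e) ≢ 0) × (∀ v → inflow k v % q ≡ outflow k v % q)

  isNowhereZeroFlow? : ∀ k → Dec (IsNowhereZeroFlow k)
  isNowhereZeroFlow? k =
    all? (λ e → ¬? (toℕ (Vec.lookup k e) ℕ.≟ 0))
      ×-dec all? (λ v → inflow k v % q ℕ.≟ outflow k v % q)

allVecs : ∀ q m → List (Vec (Fin q) m)
allVecs q zero    = [] ∷ []
allVecs q (suc m) = cartesianProductWith _∷_ (allFin q) (allVecs q m)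

#nowhereZeroFlows : (G : Graph) (q : ℕ) .{{_ : NonZero q}} → ℕ
#nowhereZeroFlows G q =
  length (filter (isNowhereZeroFlow? G q) (allVecs q (Graph.#edges G)))

------------------------------------------------------------------------
-- The polynomial ring ℚ[x]

infix  4 _≈ₚ_
infixl 6 _+ₚ_ _-ₚ_
infixl 7 _*ₚ_
infix  8 -ₚ_

-- Coefficients, constant term first; trailing zeros are allowed.
Poly : Set
Poly = List ℚ

coeff : Poly → ℕ → ℚ
coeff []      _       = 0ℚ
coeff (a ∷ p) zero    = a
coeff (a ∷ p) (suc k) = coeff p k

_≈ₚ_ : Poly → Poly → Set
p ≈ₚ q = ∀ k → coeff p k ≡ coeff q k

eval : Poly → ℚ → ℚ
eval p r = foldr (λ a s → a ℚ.+ r ℚ.* s) 0ℚ p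

C : ℚ → Poly
C a = a ∷ []

0ₚ 1ₚ X : Poly
0ₚ = []
1ₚ = C 1ℚ
X  = 0ℚ ∷ 1ℚ ∷ []

_+ₚ_ : Poly → Poly → Poly
[]      +ₚ q       = q
(a ∷ p) +ₚ []      = a ∷ p
(a ∷ p) +ₚ (b ∷ q) = (a ℚ.+ b) ∷ (p +ₚ q)

-ₚ_ : Poly → Poly
-ₚ p = map ℚ.-_ p

_-ₚ_ : Poly → Poly → Poly
p -ₚ q = p +ₚ (-ₚ q)

_*ₚ_ : Poly → Poly → Poly
[]      *ₚ q = []
(a ∷ p) *ₚ q = map (a ℚ.*_) q +ₚ (0ℚ ∷ (p *ₚ q))

ℚ[x] : RawRing 0ℓ 0ℓ
ℚ[x] = record
  { Carrier = Poly ; _≈_ = _≈ₚ_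
  ; _+_ = _+ₚ_ ; _*_ = _*ₚ_ ; -_ = -ₚ_ ; 0# = 0ₚ ; 1# = 1ₚ }

open import Algebra.Definitions.RawSemiring (RawRing.rawSemiring ℚ[x]) public
  using () renaming (_^_ to _^ₚ_; sum to ∑ₚ; product to ∏ₚ)

infix 4 _IsFlowPolynomialOf_

_IsFlowPolynomialOf_ : Poly → Graph → Set
F IsFlowPolynomialOf G =
  ∀ q .{{_ : NonZero q}} → eval F (+ q / 1) ≡ + #nowhereZeroFlows G q / 1

------------------------------------------------------------------------
-- The ring ℚ[x]⟦z⟧ of formal power series in z

infix  4 _≈ₛ_
infixl 6 _+ₛ_ _-ₛ_
infixl 7 _*ₛ_
infix  8 -ₛ_
infixl 8 _^ˣ

-- f k is the coefficient of zᵏ.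
Series : Set
Series = ℕ → Poly

_≈ₛ_ : Series → Series → Set
f ≈ₛ g = ∀ k → f k ≈ₚ g k

constₛ : Poly → Series
constₛ p zero    = p
constₛ p (suc _) = 0ₚ

0ₛ 1ₛ z : Series
0ₛ = constₛ 0ₚ
1ₛ = constₛ 1ₚ
z zero          = 0ₚ
z (suc zero)    = 1ₚ
z (suc (suc _)) = 0ₚ

_+ₛ_ _-ₛ_ _*ₛ_ : Series → Series → Series
(f +ₛ g) k = f k +ₚ g k
(f -ₛ g) k = f k -ₚ g k
(f *ₛ g) k = ∑ₚ {suc k} (λ i → f (toℕ i) *ₚ g (k ∸ toℕ i))

-ₛ_ : Series → Series
(-ₛ f) k = -ₚ f k

ℚ[x]⟦z⟧ : RawRing 0ℓ 0ℓ
ℚ[x]⟦z⟧ = record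
  { Carrier = Series ; _≈_ = _≈ₛ_
  ; _+_ = _+ₛ_ ; _*_ = _*ₛ_ ; -_ = -ₛ_ ; 0# = 0ₛ ; 1# = 1ₛ }

open import Algebra.Definitions.RawSemiring (RawRing.rawSemiring ℚ[x]⟦z⟧) public
  using () renaming (_^_ to _^ₛ_; sum to ∑ₛ)

∂z : Series → Series
∂z f k = C (+ suc k / 1) *ₚ f (suc k)

at-z=0 : Series → Poly
at-z=0 f = f 0

1/_! : ℕ → ℚ
1/ j ! = (+ 1 / (j !)) {{j !≢0}}

-- x (x - 1) ⋯ (x - j + 1) / j!
binomialX : ℕ → Poly
binomialX j = C (1/ j !) *ₚ ∏ₚ {j} (λ i → X -ₚ C (+ toℕ i / 1))

-- The x-th power of a series 1 + h whose h has zero constant term: the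
-- sum over all j of binomialX j times hʲ.  Only j ≤ k is summed in the
-- coefficient of zᵏ, because hʲ is divisible by zʲ.
_^ˣ : Series → Series
(f ^ˣ) k = ∑ₚ {suc k} (λ j → binomialX (toℕ j) *ₚ ((f -ₛ 1ₛ) ^ₛ toℕ j) k)

{-# OPTIONS --safe #-}
-- Fix a positive integer q.  Deletion and contraction show that q^n times the number of nowhere-zero
-- ℤ_q-flows of a graph on n vertices is the sum, over all maps θ from the vertices to q colours, of
-- the product of q [θ u = θ v] - 1 over the edges uv.  For K_n this is (-1)^(n(n-1)/2) times the sum
-- of (1 - q)^(number of monochromatic edges of θ).  On the other side, the n-th derivative of a q-th
-- power A^q is, by the Leibniz rule, the sum over θ : {1, ..., n} → {1, ..., q} of the products in
-- which the c-th factor A is differentiated once for each i with θ i = c; at z = 0, with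
-- A = Σ (1 - q)^(i(i-1)/2) z^i / i!, this is again the sum of (1 - q)^(number of monochromatic edges).
-- Two polynomials that agree at all positive integers are equal.

module Submission where

open import Algebra.Bundles using (CommutativeRing)
import Algebra.Definitions.RawSemiring as RawSemiringDefinitions
import Algebra.Properties.Semiring.Sum as SemiringSum
import Algebra.Properties.CommutativeSemigroup as CommutativeSemigroupProperties
open import Data.Fin as Fin using (Fin; zero; suc; toℕ)
import Data.Fin.Properties as FinP
open import Data.Integer as ℤ using (+_)
import Data.Integer.Properties as ℤ
open import Data.List as List using (List; []; _∷_)
import Data.List.Properties as List
open import Data.Vec as Vec using (Vec; []; _∷_; _[_]%=_; _[_]≔_)
import Data.Vec.Properties as Vec
import Data.Vec.Functional as Functional
open import Data.Nat as ℕ using (ℕ; zero; suc; NonZero; _*_; _∸_; _/_; _%_; _!)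
import Data.Nat.Properties as ℕ
import Data.Nat.DivMod as ℕ
import Data.Nat.Divisibility as ℕ
open import Data.Nat.ListAction using () renaming (sum to sumℕ)
open import Data.Nat.GeneralisedArithmetic using (iterate)
open import Data.Product using (_×_; _,_; proj₁; proj₂; ∃-syntax)
open import Data.Rational as ℚ using (ℚ; 0ℚ; 1ℚ)
import Data.Rational.Properties as ℚ
open import Data.Rational.Solver using (module +-*-Solver)
import Data.Rational.Unnormalised as ℚᵘ
import Data.Rational.Unnormalised.Properties as ℚᵘ
open import Data.Sum using (_⊎_; inj₁; inj₂)
open import Function using (_∘_)
open import Relation.Binary.PropositionalEquality
open import Relation.Nullary using (Dec; yes; no; ¬_; contradiction; _×-dec_; ¬?)
open import Defs

open +-*-Solver using (solve; _:+_; _:*_; _:-_; :-_; _:=_; con)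

open SemiringSum (CommutativeRing.semiring ℚ.+-*-commutativeRing)
  using (sum; sum-cong-≗; ∑-distrib-+; ∑-comm; *-distribˡ-sum)
open RawSemiringDefinitions ℚ.+-*-rawSemiring
  using (_^_; product)

open CommutativeSemigroupProperties ℕ.+-commutativeSemigroup using (interchange; xy∙z≈xz∙y)

open ≡-Reasoning

-- Natural numbers as rationals

-- Comparing both sides at the points x = q replaces algebra in ℚ[x] and ℚ[x]⟦z⟧ by algebra in ℚ,
-- where the formal x-th power becomes an ordinary product of q equal factors. Deletion and
-- contraction is an induction over the edge list, but the balance condition at a vertex involves
-- many edges at once. Flows are therefore counted relative to demands at the vertices, which record
-- what the edges already treated contribute. Contraction merges v into u but keeps v as an isolated
-- vertex, so the vertex set, and with it the factor q^n, never changes; the free colour of the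
-- isolated vertex absorbs the q in q [θ u = θ v]. The two sums over colourings meet through a
-- vector of counters `ms`, one per colour. On the analytic side it holds the order of
-- differentiation of each of the q factors, on the graph side the number of vertices already placed
-- in each colour class. A further vertex of colour c contributes (1 - q)^(ms c), up to sign on the
-- graph side, and raises counter c.

ι : ℕ → ℚ
ι n = + n ℚ./ 1

ι-suc : ∀ n → ι (suc n) ≡ 1ℚ ℚ.+ ι n
ι-suc n = ℚ.toℚᵘ-injective (ℚᵘ.≃-trans (ℚ.toℚᵘ-fromℚᵘ (ℚᵘ.mkℚᵘ (+ suc n) 0))
  (ℚᵘ.≃-sym (ℚᵘ.≃-trans (ℚ.toℚᵘ-homo-+ 1ℚ (ι n))
    (ℚᵘ.≃-trans (ℚᵘ.+-congʳ ℚᵘ.1ℚᵘ (ℚ.toℚᵘ-fromℚᵘ (ℚᵘ.mkℚᵘ (+ n) 0)))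
      (ℚᵘ.*≡* (cong (λ k → (+ 1 ℤ.+ k) ℤ.* + 1) (ℤ.*-identityʳ (+ n))))))))

ι-+ : ∀ m n → ι (m ℕ.+ n) ≡ ι m ℚ.+ ι n
ι-+ zero    n = sym (ℚ.+-identityˡ (ι n))
ι-+ (suc m) n = begin
  ι (suc (m ℕ.+ n))        ≡⟨ ι-suc (m ℕ.+ n) ⟩
  1ℚ ℚ.+ ι (m ℕ.+ n)       ≡⟨ cong (1ℚ ℚ.+_) (ι-+ m n) ⟩
  1ℚ ℚ.+ (ι m ℚ.+ ι n)     ≡⟨ ℚ.+-assoc 1ℚ (ι m) (ι n) ⟨
  1ℚ ℚ.+ ι m ℚ.+ ι n       ≡⟨ cong (ℚ._+ ι n) (ι-suc m) ⟨
  ι (suc m) ℚ.+ ι n        ∎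

ι-* : ∀ m n → ι (m ℕ.* n) ≡ ι m ℚ.* ι n
ι-* zero    n = sym (ℚ.*-zeroˡ (ι n))
ι-* (suc m) n = begin
  ι (n ℕ.+ m ℕ.* n)          ≡⟨ ι-+ n (m ℕ.* n) ⟩
  ι n ℚ.+ ι (m ℕ.* n)        ≡⟨ cong (ι n ℚ.+_) (ι-* m n) ⟩
  ι n ℚ.+ ι m ℚ.* ι n        ≡⟨ solve 2 (λ a b → b :+ a :* b := (con 1ℚ :+ a) :* b) refl (ι m) (ι n) ⟩
  (1ℚ ℚ.+ ι m) ℚ.* ι n       ≡⟨ cong (ℚ._* ι n) (ι-suc m) ⟨
  ι (suc m) ℚ.* ι n          ∎

ι-injective : ∀ {m n} → ι m ≡ ι n → m ≡ n
ι-injective {m} {n} eq with ℚ./-injective-≃ (ℚᵘ.mkℚᵘ (+ m) 0) (ℚᵘ.mkℚᵘ (+ n) 0) eq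
... | ℚᵘ.*≡* e = ℤ.+-injective (trans (sym (ℤ.*-identityʳ (+ m))) (trans e (ℤ.*-identityʳ (+ n))))

*-cancelˡ-≢0 : ∀ {r a b} → r ≢ 0ℚ → r ℚ.* a ≡ r ℚ.* b → a ≡ b
*-cancelˡ-≢0 {r} {a} {b} r≢0 eq = begin
  a                          ≡⟨ ℚ.*-identityˡ a ⟨
  1ℚ ℚ.* a                   ≡⟨ cong (ℚ._* a) (ℚ.*-inverseˡ r) ⟨
  ℚ.1/ r ℚ.* r ℚ.* a         ≡⟨ ℚ.*-assoc (ℚ.1/ r) r a ⟩
  ℚ.1/ r ℚ.* (r ℚ.* a)       ≡⟨ cong (ℚ.1/ r ℚ.*_) eq ⟩
  ℚ.1/ r ℚ.* (r ℚ.* b)       ≡⟨ ℚ.*-assoc (ℚ.1/ r) r b ⟨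
  ℚ.1/ r ℚ.* r ℚ.* b         ≡⟨ cong (ℚ._* b) (ℚ.*-inverseˡ r) ⟩
  1ℚ ℚ.* b                   ≡⟨ ℚ.*-identityˡ b ⟩
  b                          ∎
  where instance r-nonZero = ℚ.≢-nonZero r≢0

1/!-inverse : ∀ j → ι (j !) ℚ.* (1/ j !) ≡ 1ℚ
1/!-inverse j with j ! | j ℕ.!≢0
... | suc k | _ = ℚ.toℚᵘ-injective (ℚᵘ.≃-trans (ℚ.toℚᵘ-homo-* (ι (suc k)) (+ 1 ℚ./ suc k))
  (ℚᵘ.≃-trans (ℚᵘ.*-cong (ℚ.toℚᵘ-fromℚᵘ (ℚᵘ.mkℚᵘ (+ suc k) 0)) (ℚ.toℚᵘ-fromℚᵘ (ℚᵘ.mkℚᵘ (+ 1) k)))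
    (ℚᵘ.*≡* (cong +_ (trans (ℕ.*-identityʳ _) (trans (ℕ.*-identityʳ (suc k)) (trans (sym (ℕ.+-identityʳ (suc k))) (sym (ℕ.+-identityʳ _)))))))))

-- Evaluation of polynomials

module _ (r : ℚ) where

  eval-+ : ∀ p q → eval (p +ₚ q) r ≡ eval p r ℚ.+ eval q r
  eval-+ []      q       = sym (ℚ.+-identityˡ (eval q r))
  eval-+ (a ∷ p) []      = sym (ℚ.+-identityʳ (eval (a ∷ p) r))
  eval-+ (a ∷ p) (b ∷ q) = begin
    a ℚ.+ b ℚ.+ r ℚ.* eval (p +ₚ q) r            ≡⟨ cong (λ s → a ℚ.+ b ℚ.+ r ℚ.* s) (eval-+ p q) ⟩
    a ℚ.+ b ℚ.+ r ℚ.* (eval p r ℚ.+ eval q r)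
      ≡⟨ solve 5 (λ a b r s t → a :+ b :+ r :* (s :+ t) := (a :+ r :* s) :+ (b :+ r :* t)) refl a b r (eval p r) (eval q r) ⟩
    eval (a ∷ p) r ℚ.+ eval (b ∷ q) r            ∎

  eval-neg : ∀ p → eval (-ₚ p) r ≡ ℚ.- eval p r
  eval-neg []      = refl
  eval-neg (a ∷ p) = begin
    ℚ.- a ℚ.+ r ℚ.* eval (-ₚ p) r      ≡⟨ cong (λ s → ℚ.- a ℚ.+ r ℚ.* s) (eval-neg p) ⟩
    ℚ.- a ℚ.+ r ℚ.* (ℚ.- eval p r)     ≡⟨ solve 3 (λ a r s → :- a :+ r :* (:- s) := :- (a :+ r :* s)) refl a r (eval p r) ⟩
    ℚ.- eval (a ∷ p) r                 ∎

  eval-∸ : ∀ p q → eval (p -ₚ q) r ≡ eval p r ℚ.- eval q r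
  eval-∸ p q = trans (eval-+ p (-ₚ q)) (cong (eval p r ℚ.+_) (eval-neg q))

  eval-scale : ∀ a p → eval (List.map (a ℚ.*_) p) r ≡ a ℚ.* eval p r
  eval-scale a []      = sym (ℚ.*-zeroʳ a)
  eval-scale a (b ∷ p) = begin
    a ℚ.* b ℚ.+ r ℚ.* eval (List.map (a ℚ.*_) p) r   ≡⟨ cong (λ s → a ℚ.* b ℚ.+ r ℚ.* s) (eval-scale a p) ⟩
    a ℚ.* b ℚ.+ r ℚ.* (a ℚ.* eval p r)
      ≡⟨ solve 4 (λ a b r s → a :* b :+ r :* (a :* s) := a :* (b :+ r :* s)) refl a b r (eval p r) ⟩
    a ℚ.* eval (b ∷ p) r                             ∎

  eval-* : ∀ p q → eval (p *ₚ q) r ≡ eval p r ℚ.* eval q r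
  eval-* []      q = sym (ℚ.*-zeroˡ (eval q r))
  eval-* (a ∷ p) q = begin
    eval (List.map (a ℚ.*_) q +ₚ (0ℚ ∷ (p *ₚ q))) r
      ≡⟨ eval-+ (List.map (a ℚ.*_) q) (0ℚ ∷ (p *ₚ q)) ⟩
    eval (List.map (a ℚ.*_) q) r ℚ.+ (0ℚ ℚ.+ r ℚ.* eval (p *ₚ q) r)
      ≡⟨ cong₂ (λ s t → s ℚ.+ (0ℚ ℚ.+ r ℚ.* t)) (eval-scale a q) (eval-* p q) ⟩
    a ℚ.* eval q r ℚ.+ (0ℚ ℚ.+ r ℚ.* (eval p r ℚ.* eval q r))
      ≡⟨ solve 4 (λ a r s t → a :* t :+ (con 0ℚ :+ r :* (s :* t)) := (a :+ r :* s) :* t) refl a r (eval p r) (eval q r) ⟩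
    eval (a ∷ p) r ℚ.* eval q r ∎

  eval-C : ∀ a → eval (C a) r ≡ a
  eval-C a = solve 2 (λ a r → a :+ r :* con 0ℚ := a) refl a r

  eval-X : eval X r ≡ r
  eval-X = solve 1 (λ r → con 0ℚ :+ r :* (con 1ℚ :+ r :* con 0ℚ) := r) refl r

  eval-^ : ∀ p n → eval (p ^ₚ n) r ≡ eval p r ^ n
  eval-^ p zero    = eval-C 1ℚ
  eval-^ p (suc n) = trans (eval-* p (p ^ₚ n)) (cong (eval p r ℚ.*_) (eval-^ p n))

  eval-∑ : ∀ {n} (f : Fin n → Poly) → eval (∑ₚ f) r ≡ sum (λ i → eval (f i) r)
  eval-∑ {zero}  f = refl
  eval-∑ {suc n} f = trans (eval-+ (f zero) (∑ₚ (f ∘ suc))) (cong (eval (f zero) r ℚ.+_) (eval-∑ (f ∘ suc)))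

  eval-∏ : ∀ {n} (f : Fin n → Poly) → eval (∏ₚ f) r ≡ product (λ i → eval (f i) r)
  eval-∏ {zero}  f = eval-C 1ℚ
  eval-∏ {suc n} f = trans (eval-* (f zero) (∏ₚ (f ∘ suc))) (cong (eval (f zero) r ℚ.*_) (eval-∏ (f ∘ suc)))

-- The quotient of a ∷ p by X - r, which does not depend on the constant term a.
quotient : ℚ → Poly → Poly
quotient r []      = []
quotient r (b ∷ p) = eval (b ∷ p) r ∷ quotient r p

length-quotient : ∀ r p → List.length (quotient r p) ≡ List.length p
length-quotient r []      = refl
length-quotient r (b ∷ p) = cong suc (length-quotient r p)

-- Remainder theorem. In Horner's scheme the coefficients of the quotient are the values at `r` of
-- the successive tails of the coefficient list.
eval-quotient : ∀ r a p x → eval (a ∷ p) x ≡ eval (a ∷ p) r ℚ.+ (x ℚ.- r) ℚ.* eval (quotient r p) x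
eval-quotient r a []      x = solve 3 (λ a x r → a :+ x :* con 0ℚ := a :+ r :* con 0ℚ :+ (x :- r) :* con 0ℚ) refl a x r
eval-quotient r a (b ∷ p) x = begin
  a ℚ.+ x ℚ.* eval (b ∷ p) x
    ≡⟨ cong (λ s → a ℚ.+ x ℚ.* s) (eval-quotient r b p x) ⟩
  a ℚ.+ x ℚ.* (eval (b ∷ p) r ℚ.+ (x ℚ.- r) ℚ.* eval (quotient r p) x)
    ≡⟨ solve 5 (λ a x r s t → a :+ x :* (s :+ (x :- r) :* t) := a :+ r :* s :+ (x :- r) :* (s :+ x :* t))
         refl a x r (eval (b ∷ p) r) (eval (quotient r p) x) ⟩
  a ℚ.+ r ℚ.* eval (b ∷ p) r ℚ.+ (x ℚ.- r) ℚ.* (eval (b ∷ p) r ℚ.+ x ℚ.* eval (quotient r p) x) ∎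

-- If the quotient vanishes, every proper tail has value 0 at `r`. A coefficient is the value of its
-- tail minus `r` times the value of the next one, hence 0.
quotient≈0⇒≈0 : ∀ r a p → eval (a ∷ p) r ≡ 0ℚ → quotient r p ≈ₚ 0ₚ → a ∷ p ≈ₚ 0ₚ
quotient≈0⇒≈0 r a []      root q≈0 zero    = trans (sym (eval-C r a)) root
quotient≈0⇒≈0 r a []      root q≈0 (suc k) = refl
quotient≈0⇒≈0 r a (b ∷ p) root q≈0 zero    = begin
  a                           ≡⟨ solve 2 (λ a r → a := a :+ r :* con 0ℚ) refl a r ⟩
  a ℚ.+ r ℚ.* 0ℚ              ≡⟨ cong (λ s → a ℚ.+ r ℚ.* s) (q≈0 0) ⟨
  eval (a ∷ b ∷ p) r          ≡⟨ root ⟩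
  0ℚ                          ∎
quotient≈0⇒≈0 r a (b ∷ p) root q≈0 (suc k) = quotient≈0⇒≈0 r b p (q≈0 0) (q≈0 ∘ suc) k

-- The root `ι s` is divided out; the points beyond `s` remain roots of the quotient, so the
-- threshold moves up as the length drops. The length `ℓ` is explicit because `quotient` does not
-- return a subterm.
vanishing⇒≈0 : ∀ ℓ p → List.length p ≡ ℓ → ∀ s → (∀ q → s ℕ.≤ q → eval p (ι q) ≡ 0ℚ) → p ≈ₚ 0ₚ
vanishing⇒≈0 ℓ       []      len s vanish = λ _ → refl
vanishing⇒≈0 (suc ℓ) (a ∷ p) len s vanish =
  quotient≈0⇒≈0 (ι s) a p (vanish s ℕ.≤-refl)
    (vanishing⇒≈0 ℓ (quotient (ι s) p) (trans (length-quotient (ι s) p) (ℕ.suc-injective len)) (suc s) vanish′)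
  where
  vanish′ : ∀ q → s ℕ.< q → eval (quotient (ι s) p) (ι q) ≡ 0ℚ
  vanish′ q s<q = *-cancelˡ-≢0 ιq-ιs≢0 (begin
    (ι q ℚ.- ι s) ℚ.* Q                                    ≡⟨ ℚ.+-identityˡ _ ⟨
    0ℚ ℚ.+ (ι q ℚ.- ι s) ℚ.* Q                             ≡⟨ cong (ℚ._+ (ι q ℚ.- ι s) ℚ.* Q) (vanish s ℕ.≤-refl) ⟨
    eval (a ∷ p) (ι s) ℚ.+ (ι q ℚ.- ι s) ℚ.* Q             ≡⟨ eval-quotient (ι s) a p (ι q) ⟨
    eval (a ∷ p) (ι q)                                     ≡⟨ vanish q (ℕ.<⇒≤ s<q) ⟩
    0ℚ                                                     ≡⟨ ℚ.*-zeroʳ (ι q ℚ.- ι s) ⟨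
    (ι q ℚ.- ι s) ℚ.* 0ℚ                                   ∎)
    where
    Q = eval (quotient (ι s) p) (ι q)
    ιq-ιs≢0 : ι q ℚ.- ι s ≢ 0ℚ
    ιq-ιs≢0 eq = ℕ.<⇒≢ s<q (sym (ι-injective (begin
      ι q                          ≡⟨ solve 2 (λ x y → x := (x :- y) :+ y) refl (ι q) (ι s) ⟩
      ι q ℚ.- ι s ℚ.+ ι s          ≡⟨ cong (ℚ._+ ι s) eq ⟩
      0ℚ ℚ.+ ι s                   ≡⟨ ℚ.+-identityˡ (ι s) ⟩
      ι s                          ∎)))

coeff-+ : ∀ p q k → coeff (p +ₚ q) k ≡ coeff p k ℚ.+ coeff q k
coeff-+ []      q       k       = sym (ℚ.+-identityˡ (coeff q k))
coeff-+ (a ∷ p) []      k       = sym (ℚ.+-identityʳ (coeff (a ∷ p) k))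
coeff-+ (a ∷ p) (b ∷ q) zero    = refl
coeff-+ (a ∷ p) (b ∷ q) (suc k) = coeff-+ p q k

coeff-neg : ∀ p k → coeff (-ₚ p) k ≡ ℚ.- coeff p k
coeff-neg []      k       = refl
coeff-neg (a ∷ p) zero    = refl
coeff-neg (a ∷ p) (suc k) = coeff-neg p k

eval-positive⇒≈ : ∀ p p′ → (∀ q → eval p (ι (suc q)) ≡ eval p′ (ι (suc q))) → p ≈ₚ p′
eval-positive⇒≈ p p′ agree k = begin
  coeff p k
    ≡⟨ solve 2 (λ x y → x := (x :- y) :+ y) refl (coeff p k) (coeff p′ k) ⟩
  coeff p k ℚ.- coeff p′ k ℚ.+ coeff p′ k
    ≡⟨ cong (ℚ._+ coeff p′ k) (trans (coeff-+ p (-ₚ p′) k) (cong (coeff p k ℚ.+_) (coeff-neg p′ k))) ⟨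
  coeff (p -ₚ p′) k ℚ.+ coeff p′ k
    ≡⟨ cong (ℚ._+ coeff p′ k) (vanishing⇒≈0 _ (p -ₚ p′) refl 1 vanish k) ⟩
  0ℚ ℚ.+ coeff p′ k
    ≡⟨ ℚ.+-identityˡ _ ⟩
  coeff p′ k ∎
  where
  vanish : ∀ q → 1 ℕ.≤ q → eval (p -ₚ p′) (ι q) ≡ 0ℚ
  vanish (suc q) _ = begin
    eval (p -ₚ p′) (ι (suc q))                           ≡⟨ eval-∸ (ι (suc q)) p p′ ⟩
    eval p (ι (suc q)) ℚ.- eval p′ (ι (suc q))           ≡⟨ cong (ℚ._- eval p′ (ι (suc q))) (agree q) ⟩
    eval p′ (ι (suc q)) ℚ.- eval p′ (ι (suc q))          ≡⟨ ℚ.+-inverseʳ (eval p′ (ι (suc q))) ⟩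
    0ℚ                                                   ∎

-- Power series with rational coefficients

infixl 7 _⊛_

_⊛_ : (ℕ → ℚ) → (ℕ → ℚ) → ℕ → ℚ
(f ⊛ g) k = sum {suc k} (λ i → f (toℕ i) ℚ.* g (k ∸ toℕ i))

one : ℕ → ℚ
one zero    = 1ℚ
one (suc _) = 0ℚ

pow : (ℕ → ℚ) → ℕ → ℕ → ℚ
pow f zero    = one
pow f (suc n) = f ⊛ pow f n

∂ : (ℕ → ℚ) → ℕ → ℚ
∂ f k = ι (suc k) ℚ.* f (suc k)

sum-zero : ∀ {n} (f : Fin n → ℚ) → (∀ i → f i ≡ 0ℚ) → sum f ≡ 0ℚ
sum-zero {zero}  f f≡0 = refl
sum-zero {suc n} f f≡0 = cong₂ ℚ._+_ (f≡0 zero) (sum-zero (f ∘ suc) (f≡0 ∘ suc))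

sum-snoc : ∀ n (f : ℕ → ℚ) → sum {suc n} (f ∘ toℕ) ≡ sum {n} (f ∘ toℕ) ℚ.+ f n
sum-snoc zero    f = ℚ.+-comm (f 0) 0ℚ
sum-snoc (suc n) f = trans (cong (f 0 ℚ.+_) (sum-snoc n (f ∘ suc))) (sym (ℚ.+-assoc (f 0) _ (f (suc n))))

⊛-cong-≤ : ∀ {f f′ g g′} k → (∀ i → i ℕ.≤ k → f i ≡ f′ i) → (∀ i → i ℕ.≤ k → g i ≡ g′ i) → (f ⊛ g) k ≡ (f′ ⊛ g′) k
⊛-cong-≤ k f≡f′ g≡g′ = sum-cong-≗ (λ i →
  cong₂ ℚ._*_ (f≡f′ (toℕ i) (FinP.toℕ≤pred[n] i)) (g≡g′ (k ∸ toℕ i) (ℕ.m∸n≤m k (toℕ i))))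

⊛-cong : ∀ {f f′ g g′} → f ≗ f′ → g ≗ g′ → f ⊛ g ≗ f′ ⊛ g′
⊛-cong f≗f′ g≗g′ k = ⊛-cong-≤ k (λ i _ → f≗f′ i) (λ i _ → g≗g′ i)

pow-cong : ∀ {f g} → f ≗ g → ∀ n → pow f n ≗ pow g n
pow-cong f≗g zero    k = refl
pow-cong f≗g (suc n) k = ⊛-cong f≗g (pow-cong f≗g n) k

⊛-distribʳ-+ : ∀ f g h → (λ k → f k ℚ.+ g k) ⊛ h ≗ (λ k → (f ⊛ h) k ℚ.+ (g ⊛ h) k)
⊛-distribʳ-+ f g h k = trans
  (sum-cong-≗ {suc k} (λ i → ℚ.*-distribʳ-+ (h (k ∸ toℕ i)) (f (toℕ i)) (g (toℕ i))))
  (∑-distrib-+ {suc k} (λ i → f (toℕ i) ℚ.* h (k ∸ toℕ i)) (λ i → g (toℕ i) ℚ.* h (k ∸ toℕ i)))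

⊛-distribˡ-sum : ∀ {n} f (g : Fin n → ℕ → ℚ) → f ⊛ (λ k → sum (λ j → g j k)) ≗ (λ k → sum (λ j → (f ⊛ g j) k))
⊛-distribˡ-sum {n} f g k = trans
  (sum-cong-≗ {suc k} (λ i → *-distribˡ-sum (f (toℕ i)) (λ j → g j (k ∸ toℕ i))))
  (∑-comm {suc k} {n} (λ i j → f (toℕ i) ℚ.* g j (k ∸ toℕ i)))

⊛-scaleʳ : ∀ c f g → f ⊛ (λ k → c ℚ.* g k) ≗ (λ k → c ℚ.* (f ⊛ g) k)
⊛-scaleʳ c f g k = trans
  (sum-cong-≗ {suc k} (λ i → solve 3 (λ c x y → x :* (c :* y) := c :* (x :* y)) refl c (f (toℕ i)) (g (k ∸ toℕ i))))
  (sym (*-distribˡ-sum {suc k} c (λ i → f (toℕ i) ℚ.* g (k ∸ toℕ i))))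

⊛-const : ∀ f g → (∀ i → f (suc i) ≡ 0ℚ) → f ⊛ g ≗ (λ k → f 0 ℚ.* g k)
⊛-const f g f≡0 zero    = ℚ.+-identityʳ _
⊛-const f g f≡0 (suc k) = trans
  (cong (f 0 ℚ.* g (suc k) ℚ.+_) (sum-zero {suc k} _ (λ i → trans (cong (ℚ._* g (k ∸ toℕ i)) (f≡0 (toℕ i))) (ℚ.*-zeroˡ (g (k ∸ toℕ i))))))
  (ℚ.+-identityʳ _)

one-⊛ : ∀ g → one ⊛ g ≗ g
one-⊛ g k = trans (⊛-const one g (λ _ → refl) k) (ℚ.*-identityˡ (g k))

-- Induction on the index, by writing f as f 0 + z f₁. Since ι (2 + k) = 1 + ι (1 + k),
-- differentiating z u produces u + z u′, applied once to u = f₁ ⊛ g and once to u = f₁.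
∂-⊛ : ∀ f g → ∂ (f ⊛ g) ≗ (λ k → (∂ f ⊛ g) k ℚ.+ (f ⊛ ∂ g) k)
∂-⊛ f g zero = solve 4 (λ x x′ y y′ →
  con 1ℚ :* (x :* y′ :+ (x′ :* y :+ con 0ℚ)) := (con 1ℚ :* x′ :* y :+ con 0ℚ) :+ (x :* (con 1ℚ :* y′) :+ con 0ℚ))
  refl (f 0) (f 1) (g 0) (g 1)
∂-⊛ f g (suc k) = begin
  ι (2 ℕ.+ k) ℚ.* (f 0 ℚ.* g (2 ℕ.+ k) ℚ.+ (f₁ ⊛ g) (suc k))
    ≡⟨ ℚ.*-distribˡ-+ (ι (2 ℕ.+ k)) _ _ ⟩
  ι (2 ℕ.+ k) ℚ.* (f 0 ℚ.* g (2 ℕ.+ k)) ℚ.+ ι (2 ℕ.+ k) ℚ.* (f₁ ⊛ g) (suc k)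
    ≡⟨ cong (λ s → ι (2 ℕ.+ k) ℚ.* (f 0 ℚ.* g (2 ℕ.+ k)) ℚ.+ s) (begin
         ι (2 ℕ.+ k) ℚ.* (f₁ ⊛ g) (suc k)
           ≡⟨ cong (ℚ._* (f₁ ⊛ g) (suc k)) (ι-suc (suc k)) ⟩
         (1ℚ ℚ.+ ι (suc k)) ℚ.* (f₁ ⊛ g) (suc k)
           ≡⟨ solve 2 (λ a s → (con 1ℚ :+ a) :* s := s :+ a :* s) refl (ι (suc k)) ((f₁ ⊛ g) (suc k)) ⟩
         (f₁ ⊛ g) (suc k) ℚ.+ ∂ (f₁ ⊛ g) k
           ≡⟨ cong ((f₁ ⊛ g) (suc k) ℚ.+_) (∂-⊛ f₁ g k) ⟩
         (f₁ ⊛ g) (suc k) ℚ.+ ((∂ f₁ ⊛ g) k ℚ.+ (f₁ ⊛ ∂ g) k) ∎) ⟩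
  ι (2 ℕ.+ k) ℚ.* (f 0 ℚ.* g (2 ℕ.+ k)) ℚ.+ (f 1 ℚ.* g (suc k) ℚ.+ (f₂ ⊛ g) k ℚ.+ ((∂ f₁ ⊛ g) k ℚ.+ (f₁ ⊛ ∂ g) k))
    ≡⟨ solve 8 (λ c x x′ y y′ s t u →
         c :* (x :* y′) :+ (x′ :* y :+ s :+ (t :+ u)) := con 1ℚ :* x′ :* y :+ (t :+ s) :+ (x :* (c :* y′) :+ u))
         refl (ι (2 ℕ.+ k)) (f 0) (f 1) (g (suc k)) (g (2 ℕ.+ k)) ((f₂ ⊛ g) k) ((∂ f₁ ⊛ g) k) ((f₁ ⊛ ∂ g) k) ⟩
  ∂ f 0 ℚ.* g (suc k) ℚ.+ ((∂ f₁ ⊛ g) k ℚ.+ (f₂ ⊛ g) k) ℚ.+ (f 0 ℚ.* ∂ g (suc k) ℚ.+ (f₁ ⊛ ∂ g) k)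
    ≡⟨ cong (λ s → ∂ f 0 ℚ.* g (suc k) ℚ.+ s ℚ.+ (f 0 ℚ.* ∂ g (suc k) ℚ.+ (f₁ ⊛ ∂ g) k)) (begin
         (∂ f ∘ suc ⊛ g) k
           ≡⟨ ⊛-cong {g = g} (λ i → begin
                ι (2 ℕ.+ i) ℚ.* f (2 ℕ.+ i)
                  ≡⟨ cong (ℚ._* f (2 ℕ.+ i)) (ι-suc (suc i)) ⟩
                (1ℚ ℚ.+ ι (suc i)) ℚ.* f (2 ℕ.+ i)
                  ≡⟨ solve 2 (λ a s → (con 1ℚ :+ a) :* s := a :* s :+ s) refl (ι (suc i)) (f (2 ℕ.+ i)) ⟩
                ∂ f₁ i ℚ.+ f₂ i ∎) (λ _ → refl) k ⟩
         ((λ i → ∂ f₁ i ℚ.+ f₂ i) ⊛ g) k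
           ≡⟨ ⊛-distribʳ-+ (∂ f₁) f₂ g k ⟩
         (∂ f₁ ⊛ g) k ℚ.+ (f₂ ⊛ g) k ∎) ⟨
  (∂ f ⊛ g) (suc k) ℚ.+ (f ⊛ ∂ g) (suc k) ∎
  where
  f₁ = f ∘ suc
  f₂ = f₁ ∘ suc

∂-iterate : ∀ n f → ∂ (iterate ∂ f n) ≡ iterate ∂ f (suc n)
∂-iterate zero    f = refl
∂-iterate (suc n) f = ∂-iterate n (∂ f)

-- Multiplying by `k !` turns the falling factorial (n + k) ⋯ (k + 1) into a quotient-free statement
-- about factorials.
iterate-∂-coeff : ∀ n f k → ι (k !) ℚ.* iterate ∂ f n k ≡ ι ((n ℕ.+ k) !) ℚ.* f (n ℕ.+ k)
iterate-∂-coeff zero    f k = refl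
iterate-∂-coeff (suc n) f k = begin
  ι (k !) ℚ.* iterate ∂ (∂ f) n k                                    ≡⟨ iterate-∂-coeff n (∂ f) k ⟩
  ι (m !) ℚ.* (ι (suc m) ℚ.* f (suc m))
    ≡⟨ solve 3 (λ a b c → a :* (b :* c) := b :* a :* c) refl (ι (m !)) (ι (suc m)) (f (suc m)) ⟩
  ι (suc m) ℚ.* ι (m !) ℚ.* f (suc m)                                ≡⟨ cong (ℚ._* f (suc m)) (ι-* (suc m) (m !)) ⟨
  ι (suc m !) ℚ.* f (suc m)                                          ∎
  where m = n ℕ.+ k

iterate-∂-at-0 : ∀ n f → iterate ∂ f n 0 ≡ ι (n !) ℚ.* f n
iterate-∂-at-0 n f = begin
  iterate ∂ f n 0                    ≡⟨ ℚ.*-identityˡ _ ⟨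
  1ℚ ℚ.* iterate ∂ f n 0             ≡⟨ iterate-∂-coeff n f 0 ⟩
  ι ((n ℕ.+ 0) !) ℚ.* f (n ℕ.+ 0)    ≡⟨ cong (λ k → ι (k !) ℚ.* f k) (ℕ.+-identityʳ n) ⟩
  ι (n !) ℚ.* f n                    ∎

pow-order : ∀ {h} → h 0 ≡ 0ℚ → ∀ j k → k ℕ.< j → pow h j k ≡ 0ℚ
pow-order {h} h₀≡0 (suc j) k k<1+j = sum-zero {suc k} _ term
  where
  term : ∀ (i : Fin (suc k)) → h (toℕ i) ℚ.* pow h j (k ∸ toℕ i) ≡ 0ℚ
  term zero    = trans (cong (ℚ._* pow h j k) h₀≡0) (ℚ.*-zeroˡ (pow h j k))
  term (suc i) = trans (cong (h (suc (toℕ i)) ℚ.*_) (pow-order h₀≡0 j _ (k∸1+i<j k k<1+j i))) (ℚ.*-zeroʳ (h (suc (toℕ i))))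
    where
    k∸1+i<j : ∀ k → k ℕ.< suc j → (i : Fin k) → k ∸ suc (toℕ i) ℕ.< j
    k∸1+i<j (suc k) k<j i = ℕ.≤-<-trans (ℕ.m∸n≤m k (toℕ i)) (ℕ.s≤s⁻¹ k<j)

-- The binomial series at natural exponents

fallingFactorial : ℚ → ℕ → ℚ
fallingFactorial r j = product {j} (λ i → r ℚ.- ι (toℕ i))

binomial : ℚ → ℕ → ℚ
binomial r j = (1/ j !) ℚ.* fallingFactorial r j

fallingFactorial-snoc : ∀ r j → fallingFactorial r (suc j) ≡ fallingFactorial r j ℚ.* (r ℚ.- ι j)
fallingFactorial-snoc r j = snoc j (λ i → r ℚ.- ι i)
  where
  snoc : ∀ n (f : ℕ → ℚ) → product {suc n} (f ∘ toℕ) ≡ product {n} (f ∘ toℕ) ℚ.* f n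
  snoc zero    f = ℚ.*-comm (f 0) 1ℚ
  snoc (suc n) f = trans (cong (f 0 ℚ.*_) (snoc n (f ∘ suc))) (sym (ℚ.*-assoc (f 0) _ (f (suc n))))

product-cong : ∀ {n} {f g : Fin n → ℚ} → f ≗ g → product f ≡ product g
product-cong {zero}  f≗g = refl
product-cong {suc n} f≗g = cong₂ ℚ._*_ (f≗g zero) (product-cong (f≗g ∘ suc))

fallingFactorial-suc : ∀ r j → fallingFactorial (1ℚ ℚ.+ r) (suc j) ≡ (1ℚ ℚ.+ r) ℚ.* fallingFactorial r j
fallingFactorial-suc r j = cong₂ ℚ._*_ (ℚ.+-identityʳ (1ℚ ℚ.+ r)) (product-cong {j} (λ i → begin
  1ℚ ℚ.+ r ℚ.- ι (suc (toℕ i))         ≡⟨ cong (λ x → 1ℚ ℚ.+ r ℚ.- x) (ι-suc (toℕ i)) ⟩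
  1ℚ ℚ.+ r ℚ.- (1ℚ ℚ.+ ι (toℕ i))      ≡⟨ solve 2 (λ r x → con 1ℚ :+ r :- (con 1ℚ :+ x) := r :- x) refl r (ι (toℕ i)) ⟩
  r ℚ.- ι (toℕ i)                      ∎))

1/!-suc : ∀ j → ι (suc j) ℚ.* (1/ suc j !) ≡ 1/ j !
1/!-suc j = *-cancelˡ-≢0 ιj!≢0 (begin
  ι (j !) ℚ.* (ι (suc j) ℚ.* (1/ suc j !))
    ≡⟨ solve 3 (λ a b c → a :* (b :* c) := b :* a :* c) refl (ι (j !)) (ι (suc j)) (1/ suc j !) ⟩
  ι (suc j) ℚ.* ι (j !) ℚ.* (1/ suc j !)     ≡⟨ cong (ℚ._* (1/ suc j !)) (ι-* (suc j) (j !)) ⟨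
  ι (suc j !) ℚ.* (1/ suc j !)               ≡⟨ 1/!-inverse (suc j) ⟩
  1ℚ                                         ≡⟨ 1/!-inverse j ⟨
  ι (j !) ℚ.* (1/ j !)                       ∎)
  where
  ιj!≢0 : ι (j !) ≢ 0ℚ
  ιj!≢0 eq = ℕ.≢-nonZero⁻¹ (j !) {{j ℕ.!≢0}} (ι-injective eq)

-- Both binomials of order j + 1 contain the falling factorial of `r` of length j; the cofactors
-- satisfy 1 + r = (r - j) + (1 + j), and 1 + j cancels against (j + 1)!.
pascal : ∀ r j → binomial (1ℚ ℚ.+ r) (suc j) ≡ binomial r (suc j) ℚ.+ binomial r j
pascal r j = begin
  e′ ℚ.* fallingFactorial (1ℚ ℚ.+ r) (suc j)         ≡⟨ cong (e′ ℚ.*_) (fallingFactorial-suc r j) ⟩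
  e′ ℚ.* ((1ℚ ℚ.+ r) ℚ.* F)
    ≡⟨ solve 4 (λ e r F x → e :* ((con 1ℚ :+ r) :* F) := e :* (F :* (r :- x)) :+ (con 1ℚ :+ x) :* e :* F) refl e′ r F (ι j) ⟩
  e′ ℚ.* (F ℚ.* (r ℚ.- ι j)) ℚ.+ (1ℚ ℚ.+ ι j) ℚ.* e′ ℚ.* F
    ≡⟨ cong₂ (λ s t → e′ ℚ.* s ℚ.+ t ℚ.* F) (fallingFactorial-snoc r j)
         (trans (sym (1/!-suc j)) (cong (ℚ._* e′) (ι-suc j))) ⟨
  e′ ℚ.* fallingFactorial r (suc j) ℚ.+ (1/ j !) ℚ.* F ∎
  where
  e′ = 1/ suc j !
  F  = fallingFactorial r j

-- The cut-off `N` is any bound on `k`, so that in the induction one and the same finite sum serves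
-- for all coefficients of `pow g n` that enter the convolution at `k`. Multiplication by 1 + h
-- shifts this sum by one power of h, and Pascal's rule recombines the pieces.
pow≡binomial-series : ∀ {g h} → h 0 ≡ 0ℚ → (∀ k → g k ≡ one k ℚ.+ h k) → ∀ n N k → k ℕ.≤ N →
  pow g n k ≡ sum {suc N} (λ j → binomial (ι n) (toℕ j) ℚ.* pow h (toℕ j) k)
pow≡binomial-series {g} {h} h₀≡0 g≡1+h zero N k k≤N = sym (begin
  binomial 0ℚ 0 ℚ.* one k ℚ.+ sum {N} (λ j → binomial 0ℚ (suc (toℕ j)) ℚ.* pow h (suc (toℕ j)) k)
    ≡⟨ cong₂ ℚ._+_ (ℚ.*-identityˡ (one k)) (sum-zero {N} _ (λ j → trans (cong (ℚ._* pow h (suc (toℕ j)) k) (vanish (toℕ j))) (ℚ.*-zeroˡ (pow h (suc (toℕ j)) k)))) ⟩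
  one k ℚ.+ 0ℚ
    ≡⟨ ℚ.+-identityʳ (one k) ⟩
  one k ∎)
  where
  vanish : ∀ j → binomial 0ℚ (suc j) ≡ 0ℚ
  vanish j = solve 2 (λ e F → e :* (con 0ℚ :* F) := con 0ℚ) refl (1/ suc j !) (product {j} (λ i → 0ℚ ℚ.- ι (suc (toℕ i))))
pow≡binomial-series {g} {h} h₀≡0 g≡1+h (suc n) N k k≤N = begin
  (g ⊛ pow g n) k
    ≡⟨ ⊛-cong-≤ {g = pow g n} {Φ} k (λ i _ → g≡1+h i) (λ i i≤k → pow≡binomial-series h₀≡0 g≡1+h n N i (ℕ.≤-trans i≤k k≤N)) ⟩
  ((λ i → one i ℚ.+ h i) ⊛ Φ) k
    ≡⟨ ⊛-distribʳ-+ one h Φ k ⟩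
  (one ⊛ Φ) k ℚ.+ (h ⊛ Φ) k
    ≡⟨ cong₂ ℚ._+_ (one-⊛ Φ k) (trans (⊛-distribˡ-sum {suc N} h (λ j i → b (toℕ j) ℚ.* pow h (toℕ j) i) k) (sum-cong-≗ {suc N} (λ j → ⊛-scaleʳ (b (toℕ j)) h (pow h (toℕ j)) k))) ⟩
  Φ k ℚ.+ sum {suc N} (λ j → b (toℕ j) ℚ.* pow h (suc (toℕ j)) k)
    ≡⟨ cong (Φ k ℚ.+_) (sum-snoc N (λ j → b j ℚ.* pow h (suc j) k)) ⟩
  Φ k ℚ.+ (S₀ ℚ.+ b N ℚ.* pow h (suc N) k)
    -- The shift creates a power of h beyond the cut-off; it is divisible by z^(N + 1) and so has no
    -- coefficient at `k`.
    ≡⟨ cong (λ s → Φ k ℚ.+ (S₀ ℚ.+ b N ℚ.* s)) (pow-order {h} h₀≡0 (suc N) k (ℕ.s≤s k≤N)) ⟩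
  b 0 ℚ.* one k ℚ.+ S₁ ℚ.+ (S₀ ℚ.+ b N ℚ.* 0ℚ)
    ≡⟨ solve 4 (λ x s t u → x :+ s :+ (t :+ u :* con 0ℚ) := x :+ (s :+ t)) refl (b 0 ℚ.* one k) S₁ S₀ (b N) ⟩
  b 0 ℚ.* one k ℚ.+ (S₁ ℚ.+ S₀)
    ≡⟨ cong (b 0 ℚ.* one k ℚ.+_) (∑-distrib-+ {N} _ _) ⟨
  b 0 ℚ.* one k ℚ.+ sum {N} (λ j → b (suc (toℕ j)) ℚ.* pow h (suc (toℕ j)) k ℚ.+ b (toℕ j) ℚ.* pow h (suc (toℕ j)) k)
    ≡⟨ cong (b 0 ℚ.* one k ℚ.+_) (sum-cong-≗ {N} (λ j → begin
         binomial (ι (suc n)) (suc (toℕ j)) ℚ.* pow h (suc (toℕ j)) k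
           ≡⟨ cong (λ x → binomial x (suc (toℕ j)) ℚ.* pow h (suc (toℕ j)) k) (ι-suc n) ⟩
         binomial (1ℚ ℚ.+ ι n) (suc (toℕ j)) ℚ.* pow h (suc (toℕ j)) k
           ≡⟨ cong (ℚ._* pow h (suc (toℕ j)) k) (pascal (ι n) (toℕ j)) ⟩
         (b (suc (toℕ j)) ℚ.+ b (toℕ j)) ℚ.* pow h (suc (toℕ j)) k
           ≡⟨ ℚ.*-distribʳ-+ (pow h (suc (toℕ j)) k) (b (suc (toℕ j))) (b (toℕ j)) ⟩
         b (suc (toℕ j)) ℚ.* pow h (suc (toℕ j)) k ℚ.+ b (toℕ j) ℚ.* pow h (suc (toℕ j)) k ∎)) ⟨
  sum {suc N} (λ j → binomial (ι (suc n)) (toℕ j) ℚ.* pow h (toℕ j) k) ∎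
  where
  b : ℕ → ℚ
  b = binomial (ι n)
  Φ : ℕ → ℚ
  Φ i = sum {suc N} (λ j → b (toℕ j) ℚ.* pow h (toℕ j) i)
  S₀ = sum {N} (λ j → b (toℕ j) ℚ.* pow h (suc (toℕ j)) k)
  S₁ = sum {N} (λ j → b (suc (toℕ j)) ℚ.* pow h (suc (toℕ j)) k)

-- Derivatives of products of power series

∑Vec : ∀ {q} n → (Vec (Fin q) n → ℚ) → ℚ
∑Vec zero    f = f []
∑Vec (suc n) f = sum (λ c → ∑Vec n (λ θ → f (c ∷ θ)))

∑Vec-cong : ∀ {q} n {f g : Vec (Fin q) n → ℚ} → f ≗ g → ∑Vec n f ≡ ∑Vec n g
∑Vec-cong zero    f≗g = f≗g []
∑Vec-cong (suc n) f≗g = sum-cong-≗ (λ c → ∑Vec-cong n (λ θ → f≗g (c ∷ θ)))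

∑Vec-scale : ∀ {q} n c (f : Vec (Fin q) n → ℚ) → ∑Vec n (λ θ → c ℚ.* f θ) ≡ c ℚ.* ∑Vec n f
∑Vec-scale zero    c f = refl
∑Vec-scale (suc n) c f = trans
  (sum-cong-≗ (λ d → ∑Vec-scale n c (λ θ → f (d ∷ θ))))
  (sym (*-distribˡ-sum c (λ d → ∑Vec n (λ θ → f (d ∷ θ)))))

∑Vec-+ : ∀ {q} n (f g : Vec (Fin q) n → ℚ) → ∑Vec n (λ θ → f θ ℚ.+ g θ) ≡ ∑Vec n f ℚ.+ ∑Vec n g
∑Vec-+ zero    f g = refl
∑Vec-+ (suc n) f g = trans
  (sum-cong-≗ (λ c → ∑Vec-+ n (λ θ → f (c ∷ θ)) (λ θ → g (c ∷ θ))))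
  (∑-distrib-+ (λ c → ∑Vec n (λ θ → f (c ∷ θ))) (λ c → ∑Vec n (λ θ → g (c ∷ θ))))

iterate-∂-sum : ∀ {q} n (f : Fin q → ℕ → ℚ) →
  iterate ∂ (λ k → sum (λ c → f c k)) n 0 ≡ sum (λ c → iterate ∂ (f c) n 0)
iterate-∂-sum n f = begin
  iterate ∂ (λ k → sum (λ c → f c k)) n 0     ≡⟨ iterate-∂-at-0 n _ ⟩
  ι (n !) ℚ.* sum (λ c → f c n)               ≡⟨ *-distribˡ-sum (ι (n !)) (λ c → f c n) ⟩
  sum (λ c → ι (n !) ℚ.* f c n)               ≡⟨ sum-cong-≗ (λ c → iterate-∂-at-0 n (f c)) ⟨
  sum (λ c → iterate ∂ (f c) n 0)             ∎

-- Pointwise equality suffices because the n-th derivative at 0 sees only the coefficient of index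
-- `n`.
iterate-∂-cong : ∀ {f g} n → f ≗ g → iterate ∂ f n 0 ≡ iterate ∂ g n 0
iterate-∂-cong {f} {g} n f≗g = begin
  iterate ∂ f n 0     ≡⟨ iterate-∂-at-0 n f ⟩
  ι (n !) ℚ.* f n     ≡⟨ cong (ι (n !) ℚ.*_) (f≗g n) ⟩
  ι (n !) ℚ.* g n     ≡⟨ iterate-∂-at-0 n g ⟨
  iterate ∂ g n 0     ∎

-- The counters tell how often each of the q copies of `g` has been differentiated; all derivatives
-- of `pow g q` are sums of such products.
∂-product : (ℕ → ℚ) → ∀ {q} → Vec ℕ q → ℕ → ℚ
∂-product g []       = one
∂-product g (m ∷ ms) = iterate ∂ g m ⊛ ∂-product g ms

-- Leibniz rule for q factors. The index `c` of the factor that absorbs the derivative will be the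
-- colour of the next vertex.
∂-∂-product : ∀ g {q} (ms : Vec ℕ q) → ∂ (∂-product g ms) ≗ (λ k → sum (λ c → ∂-product g (ms [ c ]%= suc) k))
∂-∂-product g []       k = ℚ.*-zeroʳ (ι (suc k))
∂-∂-product g {suc q} (m ∷ ms) k = begin
  ∂ (D ⊛ P) k
    ≡⟨ ∂-⊛ D P k ⟩
  (∂ D ⊛ P) k ℚ.+ (D ⊛ ∂ P) k
    ≡⟨ cong₂ (λ f s → (f ⊛ P) k ℚ.+ s) (∂-iterate m g)
         (trans (⊛-cong {D} (λ _ → refl) (∂-∂-product g ms) k)
                (⊛-distribˡ-sum D (λ c → ∂-product g (ms [ c ]%= suc)) k)) ⟩
  sum {suc q} (λ c → ∂-product g ((m ∷ ms) [ c ]%= suc) k) ∎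
  where
  D = iterate ∂ g m
  P = ∂-product g ms

∂-product-replicate : ∀ g q → ∂-product g (Vec.replicate q 0) ≡ pow g q
∂-product-replicate g zero    = refl
∂-product-replicate g (suc q) = cong (g ⊛_) (∂-product-replicate g q)

module _ (y : ℚ) where

  -- y ^ (i(i-1)/2)
  cliqueWeight : ℕ → ℚ
  cliqueWeight zero    = 1ℚ
  cliqueWeight (suc i) = y ^ i ℚ.* cliqueWeight i

  ∏cliqueWeight : ∀ {q} → Vec ℕ q → ℚ
  ∏cliqueWeight []       = 1ℚ
  ∏cliqueWeight (m ∷ ms) = cliqueWeight m ℚ.* ∏cliqueWeight ms

  -- A vertex that joins a clique on `Vec.lookup ms c` vertices adds that many edges.
  ∏cliqueWeight-suc : ∀ {q} (ms : Vec ℕ q) c → ∏cliqueWeight (ms [ c ]%= suc) ≡ ∏cliqueWeight ms ℚ.* y ^ Vec.lookup ms c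
  ∏cliqueWeight-suc (m ∷ ms) zero    = solve 3 (λ a b c → a :* b :* c := b :* c :* a) refl (y ^ m) (cliqueWeight m) (∏cliqueWeight ms)
  ∏cliqueWeight-suc (m ∷ ms) (suc c) = trans
    (cong (cliqueWeight m ℚ.*_) (∏cliqueWeight-suc ms c))
    (sym (ℚ.*-assoc (cliqueWeight m) (∏cliqueWeight ms) (y ^ Vec.lookup ms c)))

  -- y to the number of pairs that get equal colours when the vertices coloured by θ join
  -- ms c vertices of each colour c, pairs within the latter not being counted.
  monoWeight : ∀ {q n} → Vec ℕ q → Vec (Fin q) n → ℚ
  monoWeight ms []      = 1ℚ
  monoWeight ms (c ∷ θ) = y ^ Vec.lookup ms c ℚ.* monoWeight (ms [ c ]%= suc) θ

  -- Each derivative chooses a colour c and multiplies the clique weights by y^(ms c), which is the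
  -- factor that `monoWeight` takes for a vertex of colour c. The bound `N` is there because `g`
  -- will be a truncated series, whose derivatives at 0 are clique weights only up to the
  -- truncation; a counter plus the number of derivatives still to come never exceeds it.
  iterate-∂-∂-product : ∀ {g q N} → (∀ i → i ℕ.≤ N → iterate ∂ g i 0 ≡ cliqueWeight i) →
    ∀ n (ms : Vec ℕ q) → (∀ c → Vec.lookup ms c ℕ.+ n ℕ.≤ N) →
    iterate ∂ (∂-product g ms) n 0 ≡ ∏cliqueWeight ms ℚ.* ∑Vec n (monoWeight ms)
  iterate-∂-∂-product {g} {N = N} deriv zero    ms bound = trans (constant ms bound) (sym (ℚ.*-identityʳ (∏cliqueWeight ms)))
    where
    constant : ∀ {q} (ms : Vec ℕ q) → (∀ c → Vec.lookup ms c ℕ.+ 0 ℕ.≤ N) → ∂-product g ms 0 ≡ ∏cliqueWeight ms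
    constant []       bound = refl
    constant (m ∷ ms) bound = trans (ℚ.+-identityʳ _)
      (cong₂ ℚ._*_ (deriv m (subst (ℕ._≤ N) (ℕ.+-identityʳ m) (bound zero))) (constant ms (bound ∘ suc)))
  iterate-∂-∂-product {g} {N = N} deriv (suc n) ms bound = begin
    iterate ∂ (∂ (∂-product g ms)) n 0
      ≡⟨ iterate-∂-cong n (∂-∂-product g ms) ⟩
    iterate ∂ (λ k → sum (λ c → ∂-product g (ms [ c ]%= suc) k)) n 0
      ≡⟨ iterate-∂-sum n (λ c → ∂-product g (ms [ c ]%= suc)) ⟩
    sum (λ c → iterate ∂ (∂-product g (ms [ c ]%= suc)) n 0)
      ≡⟨ sum-cong-≗ (λ c → begin
           iterate ∂ (∂-product g (ms [ c ]%= suc)) n 0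
             ≡⟨ iterate-∂-∂-product deriv n (ms [ c ]%= suc) (bound-suc c) ⟩
           ∏cliqueWeight (ms [ c ]%= suc) ℚ.* ∑Vec n (monoWeight (ms [ c ]%= suc))
             ≡⟨ cong (ℚ._* ∑Vec n (monoWeight (ms [ c ]%= suc))) (∏cliqueWeight-suc ms c) ⟩
           ∏cliqueWeight ms ℚ.* y ^ Vec.lookup ms c ℚ.* ∑Vec n (monoWeight (ms [ c ]%= suc))
             ≡⟨ ℚ.*-assoc (∏cliqueWeight ms) (y ^ Vec.lookup ms c) _ ⟩
           ∏cliqueWeight ms ℚ.* (y ^ Vec.lookup ms c ℚ.* ∑Vec n (monoWeight (ms [ c ]%= suc)))
             ≡⟨ cong (∏cliqueWeight ms ℚ.*_) (∑Vec-scale n (y ^ Vec.lookup ms c) (monoWeight (ms [ c ]%= suc))) ⟨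
           ∏cliqueWeight ms ℚ.* ∑Vec n (λ θ → monoWeight ms (c ∷ θ)) ∎) ⟩
    sum (λ c → ∏cliqueWeight ms ℚ.* ∑Vec n (λ θ → monoWeight ms (c ∷ θ)))
      ≡⟨ *-distribˡ-sum (∏cliqueWeight ms) (λ c → ∑Vec n (λ θ → monoWeight ms (c ∷ θ))) ⟨
    ∏cliqueWeight ms ℚ.* ∑Vec (suc n) (monoWeight ms) ∎
    where
    bound-suc : ∀ c d → Vec.lookup (ms [ c ]%= suc) d ℕ.+ n ℕ.≤ N
    bound-suc c d = ℕ.≤-trans (ℕ.+-monoˡ-≤ n (lookup-suc≤ c d)) (subst (ℕ._≤ N) (ℕ.+-suc (Vec.lookup ms d) n) (bound d))
      where
      lookup-suc≤ : ∀ c d → Vec.lookup (ms [ c ]%= suc) d ℕ.≤ suc (Vec.lookup ms d)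
      lookup-suc≤ c d with d Fin.≟ c
      ... | yes refl = ℕ.≤-reflexive (Vec.lookup∘updateAt d ms)
      ... | no  d≢c  = ℕ.≤-trans (ℕ.≤-reflexive (Vec.lookup∘updateAt′ d c d≢c ms)) (ℕ.n≤1+n _)

-- Evaluation of power series over ℚ[x]

^-+ : ∀ y m n → y ^ (m ℕ.+ n) ≡ y ^ m ℚ.* y ^ n
^-+ y zero    n = sym (ℚ.*-identityˡ (y ^ n))
^-+ y (suc m) n = trans (cong (y ℚ.*_) (^-+ y m n)) (sym (ℚ.*-assoc y (y ^ m) (y ^ n)))

-- The multiple i * 2 of the divisor splits off exactly, so the truncating division can be handled
-- without a parity argument for i (i - 1).
triangle-suc : ∀ i → suc i * i / 2 ≡ i ℕ.+ i * (i ∸ 1) / 2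
triangle-suc i = begin
  suc i * i / 2                     ≡⟨ cong (_/ 2) (expand i) ⟩
  (i * 2 ℕ.+ i * (i ∸ 1)) / 2       ≡⟨ ℕ.+-distrib-/-∣ˡ (i * (i ∸ 1)) (ℕ.n∣m*n i) ⟩
  i * 2 / 2 ℕ.+ i * (i ∸ 1) / 2     ≡⟨ cong (ℕ._+ i * (i ∸ 1) / 2) (ℕ.m*n/n≡m i 2) ⟩
  i ℕ.+ i * (i ∸ 1) / 2             ∎
  where
  expand : ∀ i → suc i * i ≡ i * 2 ℕ.+ i * (i ∸ 1)
  expand zero    = refl
  expand (suc j) = trans (ℕ.*-distribʳ-+ (suc j) 2 j) (cong₂ ℕ._+_ (ℕ.*-comm 2 (suc j)) (ℕ.*-comm j (suc j)))

^-triangle : ∀ y i → y ^ (i * (i ∸ 1) / 2) ≡ cliqueWeight y i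
^-triangle y zero    = refl
^-triangle y (suc i) = begin
  y ^ (suc i * i / 2)                  ≡⟨ cong (y ^_) (triangle-suc i) ⟩
  y ^ (i ℕ.+ i * (i ∸ 1) / 2)          ≡⟨ ^-+ y i (i * (i ∸ 1) / 2) ⟩
  y ^ i ℚ.* y ^ (i * (i ∸ 1) / 2)      ≡⟨ cong (y ^ i ℚ.*_) (^-triangle y i) ⟩
  y ^ i ℚ.* cliqueWeight y i           ∎

module _ (r : ℚ) where

  evalₛ : Series → ℕ → ℚ
  evalₛ f k = eval (f k) r

  evalₛ-* : ∀ f g → evalₛ (f *ₛ g) ≗ evalₛ f ⊛ evalₛ g
  evalₛ-* f g k = trans
    (eval-∑ r {suc k} (λ i → f (toℕ i) *ₚ g (k ∸ toℕ i)))
    (sum-cong-≗ {suc k} (λ i → eval-* r (f (toℕ i)) (g (k ∸ toℕ i))))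

  evalₛ-1 : evalₛ 1ₛ ≗ one
  evalₛ-1 zero    = eval-C r 1ℚ
  evalₛ-1 (suc k) = refl

  evalₛ-^ : ∀ f n → evalₛ (f ^ₛ n) ≗ pow (evalₛ f) n
  evalₛ-^ f zero    k = evalₛ-1 k
  evalₛ-^ f (suc n) k = trans (evalₛ-* f (f ^ₛ n) k) (⊛-cong {evalₛ f} (λ _ → refl) (evalₛ-^ f n) k)

  evalₛ-∑ : ∀ {n} (f : Fin n → Series) k → evalₛ (∑ₛ f) k ≡ sum (λ i → evalₛ (f i) k)
  evalₛ-∑ {zero}  f zero    = refl
  evalₛ-∑ {zero}  f (suc k) = refl
  evalₛ-∑ {suc n} f k       = trans (eval-+ r (f zero k) (∑ₛ (f ∘ suc) k)) (cong (evalₛ (f zero) k ℚ.+_) (evalₛ-∑ (f ∘ suc) k))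

  evalₛ-∂z : ∀ f → evalₛ (∂z f) ≗ ∂ (evalₛ f)
  evalₛ-∂z f k = trans (eval-* r (C (ι (suc k))) (f (suc k))) (cong (ℚ._* eval (f (suc k)) r) (eval-C r (ι (suc k))))

  eval-at-0-iterate-∂z : ∀ n f → eval (at-z=0 (iterate ∂z f n)) r ≡ iterate ∂ (evalₛ f) n 0
  eval-at-0-iterate-∂z zero    f = refl
  eval-at-0-iterate-∂z (suc n) f = trans (eval-at-0-iterate-∂z n (∂z f)) (iterate-∂-cong n (evalₛ-∂z f))

  eval-binomialX : ∀ j → eval (binomialX j) r ≡ binomial r j
  eval-binomialX j = begin
    eval (C (1/ j !) *ₚ ∏ₚ factor) r               ≡⟨ eval-* r (C (1/ j !)) (∏ₚ factor) ⟩
    eval (C (1/ j !)) r ℚ.* eval (∏ₚ factor) r     ≡⟨ cong₂ ℚ._*_ (eval-C r (1/ j !)) (trans (eval-∏ r factor) (product-cong eval-factor)) ⟩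
    binomial r j                                   ∎
    where
    factor : Fin j → Poly
    factor i = X -ₚ C (ι (toℕ i))
    eval-factor : ∀ i → eval (factor i) r ≡ r ℚ.- ι (toℕ i)
    eval-factor i = trans (eval-∸ r X (C (ι (toℕ i)))) (cong₂ ℚ._-_ (eval-X r) (eval-C r (ι (toℕ i))))

  shift : ℕ → ℚ
  shift = evalₛ z

  shift-⊛-zero : ∀ f → (shift ⊛ f) 0 ≡ 0ℚ
  shift-⊛-zero f = trans (ℚ.+-identityʳ (0ℚ ℚ.* f 0)) (ℚ.*-zeroˡ (f 0))

  shift-⊛-suc : ∀ f k → (shift ⊛ f) (suc k) ≡ f k
  shift-⊛-suc f k = begin
    0ℚ ℚ.* f (suc k) ℚ.+ (shift ∘ suc ⊛ f) k      ≡⟨ cong₂ ℚ._+_ (ℚ.*-zeroˡ (f (suc k))) (⊛-const (shift ∘ suc) f (λ _ → refl) k) ⟩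
    0ℚ ℚ.+ eval 1ₚ r ℚ.* f k                      ≡⟨ ℚ.+-identityˡ _ ⟩
    eval 1ₚ r ℚ.* f k                             ≡⟨ cong (ℚ._* f k) (eval-C r 1ℚ) ⟩
    1ℚ ℚ.* f k                                    ≡⟨ ℚ.*-identityˡ (f k) ⟩
    f k                                           ∎

  -- Convolution with `shift` moves coefficients up by one, so `pow shift i` is z^i and only the
  -- summand i = k survives; k ≤ N ensures that it is among those summed.
  ∑-shift : ∀ (c : ℕ → ℚ) k N → k ℕ.≤ N → sum {suc N} (λ i → c (toℕ i) ℚ.* pow shift (toℕ i) k) ≡ c k
  ∑-shift c zero N _ = begin
    c 0 ℚ.* 1ℚ ℚ.+ sum {N} (λ i → c (suc (toℕ i)) ℚ.* pow shift (suc (toℕ i)) 0)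
      ≡⟨ cong₂ ℚ._+_ (ℚ.*-identityʳ (c 0)) (sum-zero {N} _ (λ i → trans
           (cong (c (suc (toℕ i)) ℚ.*_) (shift-⊛-zero (pow shift (toℕ i)))) (ℚ.*-zeroʳ (c (suc (toℕ i)))))) ⟩
    c 0 ℚ.+ 0ℚ
      ≡⟨ ℚ.+-identityʳ (c 0) ⟩
    c 0 ∎
  ∑-shift c (suc k) (suc N) (ℕ.s≤s k≤N) = begin
    c 0 ℚ.* 0ℚ ℚ.+ sum {suc N} (λ i → c (suc (toℕ i)) ℚ.* pow shift (suc (toℕ i)) (suc k))
      ≡⟨ cong₂ ℚ._+_ (ℚ.*-zeroʳ (c 0)) (sum-cong-≗ {suc N} (λ i →
           cong (c (suc (toℕ i)) ℚ.*_) (shift-⊛-suc (pow shift (toℕ i)) k))) ⟩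
    0ℚ ℚ.+ sum {suc N} (λ i → c (suc (toℕ i)) ℚ.* pow shift (toℕ i) k)
      ≡⟨ ℚ.+-identityˡ _ ⟩
    sum {suc N} (λ i → c (suc (toℕ i)) ℚ.* pow shift (toℕ i) k)
      ≡⟨ ∑-shift (c ∘ suc) k N k≤N ⟩
    c (suc k) ∎

  evalₛ-truncated : ∀ (p : ℕ → Poly) N k → k ℕ.≤ N →
    evalₛ (∑ₛ {suc N} (λ i → constₛ (p (toℕ i)) *ₛ z ^ₛ toℕ i)) k ≡ eval (p k) r
  evalₛ-truncated p N k k≤N = begin
    evalₛ (∑ₛ {suc N} (λ i → constₛ (p (toℕ i)) *ₛ z ^ₛ toℕ i)) k
      ≡⟨ evalₛ-∑ {suc N} (λ i → constₛ (p (toℕ i)) *ₛ z ^ₛ toℕ i) k ⟩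
    sum {suc N} (λ i → evalₛ (constₛ (p (toℕ i)) *ₛ z ^ₛ toℕ i) k)
      ≡⟨ sum-cong-≗ {suc N} (λ i → term (toℕ i)) ⟩
    sum {suc N} (λ i → eval (p (toℕ i)) r ℚ.* pow shift (toℕ i) k)
      ≡⟨ ∑-shift (λ i → eval (p i) r) k N k≤N ⟩
    eval (p k) r ∎
    where
    term : ∀ i → evalₛ (constₛ (p i) *ₛ z ^ₛ i) k ≡ eval (p i) r ℚ.* pow shift i k
    term i = begin
      evalₛ (constₛ (p i) *ₛ z ^ₛ i) k            ≡⟨ evalₛ-* (constₛ (p i)) (z ^ₛ i) k ⟩
      (evalₛ (constₛ (p i)) ⊛ evalₛ (z ^ₛ i)) k   ≡⟨ ⊛-const (evalₛ (constₛ (p i))) (evalₛ (z ^ₛ i)) (λ _ → refl) k ⟩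
      eval (p i) r ℚ.* evalₛ (z ^ₛ i) k           ≡⟨ cong (eval (p i) r ℚ.*_) (evalₛ-^ z i k) ⟩
      eval (p i) r ℚ.* pow shift i k              ∎

-- Evaluation at `ι n` specialises the coefficients and the exponent X at once. The cut-off j ≤ k in
-- the definition of `^ˣ` is the case N = k of the binomial series.
evalₛ-^ˣ : ∀ n f → eval (f 0) (ι n) ≡ 1ℚ → evalₛ (ι n) (f ^ˣ) ≗ pow (evalₛ (ι n) f) n
evalₛ-^ˣ n f f₀≡1 k = begin
  eval ((f ^ˣ) k) (ι n)
    ≡⟨ eval-∑ (ι n) {suc k} (λ j → binomialX (toℕ j) *ₚ ((f -ₛ 1ₛ) ^ₛ toℕ j) k) ⟩
  sum {suc k} (λ j → eval (binomialX (toℕ j) *ₚ ((f -ₛ 1ₛ) ^ₛ toℕ j) k) (ι n))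
    ≡⟨ sum-cong-≗ {suc k} (λ j → term (toℕ j)) ⟩
  sum {suc k} (λ j → binomial (ι n) (toℕ j) ℚ.* pow h (toℕ j) k)
    ≡⟨ pow≡binomial-series {evalₛ (ι n) f} {h} h₀≡0 f≡1+h n k k ℕ.≤-refl ⟨
  pow (evalₛ (ι n) f) n k ∎
  where
  h : ℕ → ℚ
  h = evalₛ (ι n) (f -ₛ 1ₛ)
  h≡f-1 : ∀ k → h k ≡ evalₛ (ι n) f k ℚ.- one k
  h≡f-1 k = trans (eval-∸ (ι n) (f k) (1ₛ k)) (cong (λ s → evalₛ (ι n) f k ℚ.- s) (evalₛ-1 (ι n) k))
  h₀≡0 : h 0 ≡ 0ℚ
  h₀≡0 = trans (h≡f-1 0) (cong (ℚ._- 1ℚ) f₀≡1)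
  f≡1+h : ∀ k → evalₛ (ι n) f k ≡ one k ℚ.+ h k
  f≡1+h k = trans
    (solve 2 (λ f e → f := e :+ (f :- e)) refl (evalₛ (ι n) f k) (one k))
    (cong (one k ℚ.+_) (sym (h≡f-1 k)))
  term : ∀ j → eval (binomialX j *ₚ ((f -ₛ 1ₛ) ^ₛ j) k) (ι n) ≡ binomial (ι n) j ℚ.* pow h j k
  term j = trans (eval-* (ι n) (binomialX j) (((f -ₛ 1ₛ) ^ₛ j) k))
    (cong₂ ℚ._*_ (eval-binomialX (ι n) j) (evalₛ-^ (ι n) (f -ₛ 1ₛ) j k))

cliqueSeries : ℕ → Series
cliqueSeries n = ∑ₛ {suc n} (λ i → constₛ (C (1/ toℕ i !) *ₚ (1ₚ -ₚ X) ^ₚ (toℕ i * (toℕ i ∸ 1) / 2)) *ₛ z ^ₛ toℕ i)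

eval-cliqueSeries : ∀ r n k → k ℕ.≤ n → evalₛ r (cliqueSeries n) k ≡ (1/ k !) ℚ.* cliqueWeight (1ℚ ℚ.- r) k
eval-cliqueSeries r n k k≤n = begin
  evalₛ r (cliqueSeries n) k
    ≡⟨ evalₛ-truncated r (λ i → C (1/ i !) *ₚ (1ₚ -ₚ X) ^ₚ (i * (i ∸ 1) / 2)) n k k≤n ⟩
  eval (C (1/ k !) *ₚ (1ₚ -ₚ X) ^ₚ t) r
    ≡⟨ eval-* r (C (1/ k !)) ((1ₚ -ₚ X) ^ₚ t) ⟩
  eval (C (1/ k !)) r ℚ.* eval ((1ₚ -ₚ X) ^ₚ t) r
    ≡⟨ cong₂ ℚ._*_ (eval-C r (1/ k !)) (eval-^ r (1ₚ -ₚ X) t) ⟩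
  (1/ k !) ℚ.* eval (1ₚ -ₚ X) r ^ t
    ≡⟨ cong (λ y → (1/ k !) ℚ.* y ^ t) (trans (eval-∸ r 1ₚ X) (cong₂ ℚ._-_ (eval-C r 1ℚ) (eval-X r))) ⟩
  (1/ k !) ℚ.* (1ℚ ℚ.- r) ^ t
    ≡⟨ cong ((1/ k !) ℚ.*_) (^-triangle (1ℚ ℚ.- r) k) ⟩
  (1/ k !) ℚ.* cliqueWeight (1ℚ ℚ.- r) k ∎
  where t = k * (k ∸ 1) / 2

eval-derivative : ∀ q n → eval (at-z=0 (iterate ∂z (cliqueSeries n ^ˣ) n)) (ι q) ≡
  ∑Vec n (monoWeight (1ℚ ℚ.- ι q) (Vec.replicate q 0))
eval-derivative q n = begin
  eval (at-z=0 (iterate ∂z (cliqueSeries n ^ˣ) n)) (ι q)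
    ≡⟨ eval-at-0-iterate-∂z (ι q) n (cliqueSeries n ^ˣ) ⟩
  iterate ∂ (evalₛ (ι q) (cliqueSeries n ^ˣ)) n 0
    ≡⟨ iterate-∂-cong n (evalₛ-^ˣ q (cliqueSeries n) (eval-cliqueSeries (ι q) n 0 ℕ.z≤n)) ⟩
  iterate ∂ (pow g q) n 0
    ≡⟨ cong (λ f → iterate ∂ f n 0) (∂-product-replicate g q) ⟨
  iterate ∂ (∂-product g (Vec.replicate q 0)) n 0
    -- Before any differentiation all counters are 0, so the bound holds with equality for N = n:
    -- truncating the series at z^n is just enough.
    ≡⟨ iterate-∂-∂-product y deriv n (Vec.replicate q 0) (λ c → ℕ.≤-reflexive (cong (ℕ._+ n) (Vec.lookup-replicate c 0))) ⟩
  ∏cliqueWeight y (Vec.replicate q 0) ℚ.* ∑Vec n (monoWeight y (Vec.replicate q 0))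
    ≡⟨ cong (ℚ._* ∑Vec n (monoWeight y (Vec.replicate q 0))) (∏cliqueWeight-replicate q) ⟩
  1ℚ ℚ.* ∑Vec n (monoWeight y (Vec.replicate q 0))
    ≡⟨ ℚ.*-identityˡ _ ⟩
  ∑Vec n (monoWeight y (Vec.replicate q 0)) ∎
  where
  y = 1ℚ ℚ.- ι q
  g = evalₛ (ι q) (cliqueSeries n)
  deriv : ∀ i → i ℕ.≤ n → iterate ∂ g i 0 ≡ cliqueWeight y i
  deriv i i≤n = begin
    iterate ∂ g i 0                                   ≡⟨ iterate-∂-at-0 i g ⟩
    ι (i !) ℚ.* g i                                   ≡⟨ cong (ι (i !) ℚ.*_) (eval-cliqueSeries (ι q) n i i≤n) ⟩
    ι (i !) ℚ.* ((1/ i !) ℚ.* cliqueWeight y i)       ≡⟨ ℚ.*-assoc (ι (i !)) (1/ i !) (cliqueWeight y i) ⟨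
    ι (i !) ℚ.* (1/ i !) ℚ.* cliqueWeight y i         ≡⟨ cong (ℚ._* cliqueWeight y i) (1/!-inverse i) ⟩
    1ℚ ℚ.* cliqueWeight y i                           ≡⟨ ℚ.*-identityˡ _ ⟩
    cliqueWeight y i                                  ∎
  ∏cliqueWeight-replicate : ∀ q → ∏cliqueWeight y (Vec.replicate q 0) ≡ 1ℚ
  ∏cliqueWeight-replicate zero    = refl
  ∏cliqueWeight-replicate (suc q) = trans (ℚ.*-identityˡ _) (∏cliqueWeight-replicate q)

-- Contraction of edges

𝟙 : ∀ {P : Set} → Dec P → ℚ
𝟙 (yes _) = 1ℚ
𝟙 (no  _) = 0ℚ

𝟙-cong : ∀ {P Q : Set} (P? : Dec P) (Q? : Dec Q) → (P → Q) → (Q → P) → 𝟙 P? ≡ 𝟙 Q?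
𝟙-cong (yes _) (yes _) _ _ = refl
𝟙-cong (no _)  (no _)  _ _ = refl
𝟙-cong (yes p) (no ¬q) f _ = contradiction (f p) ¬q
𝟙-cong (no ¬p) (yes q) _ g = contradiction (g q) ¬p

𝟙-true : ∀ {P : Set} (P? : Dec P) → P → 𝟙 P? ≡ 1ℚ
𝟙-true P? p = 𝟙-cong P? (yes p) (λ p → p) (λ p → p)

𝟙-false : ∀ {P : Set} (P? : Dec P) → ¬ P → 𝟙 P? ≡ 0ℚ
𝟙-false P? ¬p = 𝟙-cong P? (no ¬p) (λ p → p) (λ p → p)

sum-single : ∀ {n} (f : Fin n → ℚ) i → (∀ j → j ≢ i → f j ≡ 0ℚ) → sum f ≡ f i
sum-single {suc n} f zero    f≡0 = trans
  (cong (f zero ℚ.+_) (sum-zero (f ∘ suc) (λ j → f≡0 (suc j) (λ ())))) (ℚ.+-identityʳ (f zero))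
sum-single {suc n} f (suc i) f≡0 = trans
  (cong₂ ℚ._+_ (f≡0 zero (λ ())) (sum-single (f ∘ suc) i (λ j j≢i → f≡0 (suc j) (j≢i ∘ FinP.suc-injective))))
  (ℚ.+-identityˡ (f (suc i)))

sum-const : ∀ n x → sum {n} (λ _ → x) ≡ ι n ℚ.* x
sum-const zero    x = sym (ℚ.*-zeroˡ x)
sum-const (suc n) x = begin
  x ℚ.+ sum {n} (λ _ → x)     ≡⟨ cong (x ℚ.+_) (sum-const n x) ⟩
  x ℚ.+ ι n ℚ.* x             ≡⟨ solve 2 (λ x n → x :+ n :* x := (con 1ℚ :+ n) :* x) refl x (ι n) ⟩
  (1ℚ ℚ.+ ι n) ℚ.* x          ≡⟨ cong (ℚ._* x) (ι-suc n) ⟨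
  ι (suc n) ℚ.* x             ∎

δ-diag : ∀ {n} (u : Fin n) → δ u u ≡ 1
δ-diag u with u Fin.≟ u
... | yes _   = refl
... | no  u≢u = contradiction refl u≢u

δ-off : ∀ {n} {u v : Fin n} → u ≢ v → δ u v ≡ 0
δ-off {u = u} {v} u≢v with u Fin.≟ v
... | yes u≡v = contradiction u≡v u≢v
... | no  _   = refl

-- Contraction of an edge (u , v) merges v into u and leaves v as an isolated vertex.
contract : ∀ {n} → Fin n → Fin n → Fin n → Fin n
contract u v x with x Fin.≟ v
... | yes _ = u
... | no  _ = x

contract-cases : ∀ {n} (u v x : Fin n) → (x ≡ v × contract u v x ≡ u) ⊎ (x ≢ v × contract u v x ≡ x)
contract-cases u v x with x Fin.≟ v
... | yes x≡v = inj₁ (x≡v , refl)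
... | no  x≢v = inj₂ (x≢v , refl)

Edges : ℕ → ℕ → Set
Edges n m = Vec (Fin n × Fin n) m

contractEdges : ∀ {n m} → Fin n → Fin n → Edges n m → Edges n m
contractEdges u v = Vec.map (λ (x , y) → contract u v x , contract u v y)

-- Demands follow the contraction: that of `v` moves to `u`, and `v`, now isolated, is left with
-- none and is balanced automatically.
push : ∀ {n} → Fin n → Fin n → (Fin n → ℕ) → Fin n → ℕ
push u v I w with w Fin.≟ v | w Fin.≟ u
... | yes _ | _     = 0
... | no _  | yes _ = I u ℕ.+ I v
... | no _  | no _  = I w

infixl 6 _⊞_·_

_⊞_·_ : ∀ {n} → (Fin n → ℕ) → ℕ → Fin n → Fin n → ℕ
(I ⊞ a · x) w = I w ℕ.+ δ x w * a

push-v : ∀ {n} (u v : Fin n) I → push u v I v ≡ 0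
push-v u v I with v Fin.≟ v | v Fin.≟ u
... | yes _   | _ = refl
... | no  v≢v | _ = contradiction refl v≢v

push-u : ∀ {n} {u v : Fin n} → u ≢ v → ∀ I → push u v I u ≡ I u ℕ.+ I v
push-u {u = u} {v} u≢v I with u Fin.≟ v | u Fin.≟ u
... | yes u≡v | _       = contradiction u≡v u≢v
... | no _    | yes _   = refl
... | no _    | no  u≢u = contradiction refl u≢u

push-≢ : ∀ {n} {u v w : Fin n} → w ≢ v → w ≢ u → ∀ I → push u v I w ≡ I w
push-≢ {u = u} {v} {w} w≢v w≢u I with w Fin.≟ v | w Fin.≟ u
... | yes w≡v | _       = contradiction w≡v w≢v
... | no _    | yes w≡u = contradiction w≡u w≢u
... | no _    | no _    = refl

-- The point is `δ-contract-u`: after contraction `u` receives whatever was meant for `u` or for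
-- `v`.
push-⊞ : ∀ {n} {u v : Fin n} → u ≢ v → ∀ I a x w → push u v (I ⊞ a · x) w ≡ (push u v I ⊞ a · contract u v x) w
push-⊞ {u = u} {v} u≢v I a x w = cases (w Fin.≟ v) (w Fin.≟ u)
  where
  contract≢v : contract u v x ≢ v
  contract≢v with contract-cases u v x
  ... | inj₁ (_   , eq) = u≢v ∘ trans (sym eq)
  ... | inj₂ (x≢v , eq) = x≢v ∘ trans (sym eq)
  δ-contract-u : δ (contract u v x) u ≡ δ x u ℕ.+ δ x v
  δ-contract-u with contract-cases u v x
  ... | inj₁ (refl , eq) = begin
    δ (contract u v v) u     ≡⟨ cong (λ t → δ t u) eq ⟩
    δ u u                    ≡⟨ δ-diag u ⟩
    1                        ≡⟨ cong₂ ℕ._+_ (δ-off (u≢v ∘ sym)) (δ-diag v) ⟨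
    δ v u ℕ.+ δ v v          ∎
  ... | inj₂ (x≢v , eq) = begin
    δ (contract u v x) u     ≡⟨ cong (λ t → δ t u) eq ⟩
    δ x u                    ≡⟨ ℕ.+-identityʳ (δ x u) ⟨
    δ x u ℕ.+ 0              ≡⟨ cong (δ x u ℕ.+_) (δ-off x≢v) ⟨
    δ x u ℕ.+ δ x v          ∎
  δ-contract-≢ : w ≢ v → w ≢ u → δ (contract u v x) w ≡ δ x w
  δ-contract-≢ w≢v w≢u with contract-cases u v x
  ... | inj₁ (refl , eq) = trans (cong (λ t → δ t w) eq) (trans (δ-off (w≢u ∘ sym)) (sym (δ-off (w≢v ∘ sym))))
  ... | inj₂ (_ , eq)    = cong (λ t → δ t w) eq
  cases : Dec (w ≡ v) → Dec (w ≡ u) → push u v (I ⊞ a · x) w ≡ (push u v I ⊞ a · contract u v x) w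
  cases (yes refl) _ = begin
    push u v (I ⊞ a · x) v                         ≡⟨ push-v u v (I ⊞ a · x) ⟩
    0                                              ≡⟨ cong₂ (λ i d → i ℕ.+ d * a) (push-v u v I) (δ-off contract≢v) ⟨
    (push u v I ⊞ a · contract u v x) v            ∎
  cases (no w≢v) (no w≢u) = begin
    push u v (I ⊞ a · x) w                         ≡⟨ push-≢ w≢v w≢u (I ⊞ a · x) ⟩
    I w ℕ.+ δ x w * a                              ≡⟨ cong₂ (λ i d → i ℕ.+ d * a) (push-≢ w≢v w≢u I) (δ-contract-≢ w≢v w≢u) ⟨
    (push u v I ⊞ a · contract u v x) w            ∎
  cases (no _) (yes refl) = begin
    push u v (I ⊞ a · x) u                         ≡⟨ push-u u≢v (I ⊞ a · x) ⟩
    I u ℕ.+ δ x u * a ℕ.+ (I v ℕ.+ δ x v * a)      ≡⟨ interchange (I u) (δ x u * a) (I v) (δ x v * a) ⟩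
    I u ℕ.+ I v ℕ.+ (δ x u * a ℕ.+ δ x v * a)      ≡⟨ cong (I u ℕ.+ I v ℕ.+_) (ℕ.*-distribʳ-+ a (δ x u) (δ x v)) ⟨
    I u ℕ.+ I v ℕ.+ (δ x u ℕ.+ δ x v) * a          ≡⟨ cong₂ (λ i d → i ℕ.+ d * a) (push-u u≢v I) δ-contract-u ⟨
    (push u v I ⊞ a · contract u v x) u            ∎

-- Counting flows modulo q

module _ (p : ℕ) where

  private q = suc p

  infix 4 _≡ᵐ_

  _≡ᵐ_ : ℕ → ℕ → Set
  a ≡ᵐ b = a % q ≡ b % q

  ≡ᵐ-+ʳ : ∀ a b c → a ≡ᵐ b → a ℕ.+ c ≡ᵐ b ℕ.+ c
  ≡ᵐ-+ʳ a b c a≡b = begin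
    (a ℕ.+ c) % q               ≡⟨ ℕ.%-distribˡ-+ a c q ⟩
    (a % q ℕ.+ c % q) % q       ≡⟨ cong (λ s → (s ℕ.+ c % q) % q) a≡b ⟩
    (b % q ℕ.+ c % q) % q       ≡⟨ ℕ.%-distribˡ-+ b c q ⟨
    (b ℕ.+ c) % q               ∎

  ≡ᵐ-+ˡ : ∀ a b c → b ≡ᵐ c → a ℕ.+ b ≡ᵐ a ℕ.+ c
  ≡ᵐ-+ˡ a b c b≡c = begin
    (a ℕ.+ b) % q               ≡⟨ cong (_% q) (ℕ.+-comm a b) ⟩
    (b ℕ.+ a) % q               ≡⟨ ≡ᵐ-+ʳ b c a b≡c ⟩
    (c ℕ.+ a) % q               ≡⟨ cong (_% q) (ℕ.+-comm c a) ⟩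
    (a ℕ.+ c) % q               ∎

  -- Modulo p + 1 the number c * p is the negative of c, since c + c p = c (p + 1). This replaces
  -- subtraction throughout.
  +-inverse : ∀ a c → a ℕ.+ c ℕ.+ c * p ≡ᵐ a
  +-inverse a c = trans
    (cong (_% q) (trans (ℕ.+-assoc a c (c * p)) (cong (a ℕ.+_) (sym (ℕ.*-suc c p)))))
    (ℕ.[m+kn]%n≡m%n a c q)

  ≡ᵐ-cancelʳ : ∀ a b c → a ℕ.+ c ≡ᵐ b ℕ.+ c → a ≡ᵐ b
  ≡ᵐ-cancelʳ a b c eq = begin
    a % q                          ≡⟨ +-inverse a c ⟨
    (a ℕ.+ c ℕ.+ c * p) % q        ≡⟨ ≡ᵐ-+ʳ (a ℕ.+ c) (b ℕ.+ c) (c * p) eq ⟩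
    (b ℕ.+ c ℕ.+ c * p) % q        ≡⟨ +-inverse b c ⟩
    b % q                          ∎

  -- The residue of o - i, with i * p in the place of -i.
  difference : ℕ → ℕ → Fin q
  difference o i = Fin.fromℕ< (ℕ.m%n<n (o ℕ.+ i * p) q)

  +-difference : ∀ o i → i ℕ.+ toℕ (difference o i) ≡ᵐ o
  +-difference o i = begin
    (i ℕ.+ toℕ (difference o i)) % q     ≡⟨ cong (λ a → (i ℕ.+ a) % q) (FinP.toℕ-fromℕ< _) ⟩
    (i ℕ.+ (o ℕ.+ i * p) % q) % q        ≡⟨ ≡ᵐ-+ˡ i ((o ℕ.+ i * p) % q) (o ℕ.+ i * p) (ℕ.m%n%n≡m%n (o ℕ.+ i * p) q) ⟩
    (i ℕ.+ (o ℕ.+ i * p)) % q            ≡⟨ cong (_% q) (trans (sym (ℕ.+-assoc i o (i * p))) (cong (ℕ._+ i * p) (ℕ.+-comm i o))) ⟩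
    (o ℕ.+ i ℕ.+ i * p) % q              ≡⟨ +-inverse o i ⟩
    o % q                                ∎

  difference-unique : ∀ o i a → i ℕ.+ toℕ a ≡ᵐ o → a ≡ difference o i
  difference-unique o i a eq = FinP.toℕ-injective (begin
    toℕ a                         ≡⟨ ℕ.m<n⇒m%n≡m (FinP.toℕ<n a) ⟨
    toℕ a % q                     ≡⟨ ≡ᵐ-cancelʳ (toℕ a) (toℕ d) i (begin
      (toℕ a ℕ.+ i) % q             ≡⟨ cong (_% q) (ℕ.+-comm (toℕ a) i) ⟩
      (i ℕ.+ toℕ a) % q             ≡⟨ eq ⟩
      o % q                         ≡⟨ +-difference o i ⟨
      (i ℕ.+ toℕ d) % q             ≡⟨ cong (_% q) (ℕ.+-comm i (toℕ d)) ⟩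
      (toℕ d ℕ.+ i) % q             ∎) ⟩
    toℕ d % q                     ≡⟨ ℕ.m<n⇒m%n≡m (FinP.toℕ<n d) ⟩
    toℕ d                         ∎)
    where d = difference o i

  balanced? : ∀ {n} (I O : Fin n → ℕ) → Dec (∀ v → I v ≡ᵐ O v)
  balanced? I O = FinP.all? (λ v → I v % q ℕ.≟ O v % q)

  -- The number of nowhere-zero k for which I + inflow k and O + outflow k agree modulo q.
  flowCount : ∀ {n m} → Edges n m → (I O : Fin n → ℕ) → ℚ
  flowCount []            I O = 𝟙 (balanced? I O)
  flowCount ((u , v) ∷ E) I O = sum {p} (λ a → flowCount E (I ⊞ suc (toℕ a) · v) (O ⊞ suc (toℕ a) · u))

  -- The count depends only on the differences I - O modulo q, compared here by cross addition
  -- because subtraction on ℕ truncates. In particular, equal amounts added to both demands, as by a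
  -- loop, change nothing.
  flowCount-cong : ∀ {n m} (E : Edges n m) {I O I′ O′} →
    (∀ w → I w ℕ.+ O′ w ≡ᵐ I′ w ℕ.+ O w) → flowCount E I O ≡ flowCount E I′ O′
  flowCount-cong [] {I} {O} {I′} {O′} eq = 𝟙-cong (balanced? I O) (balanced? I′ O′)
    (λ bal w → ≡ᵐ-cancelʳ (I′ w) (O′ w) (O w) (begin
      (I′ w ℕ.+ O w) % q       ≡⟨ eq w ⟨
      (I w ℕ.+ O′ w) % q       ≡⟨ ≡ᵐ-+ʳ (I w) (O w) (O′ w) (bal w) ⟩
      (O w ℕ.+ O′ w) % q       ≡⟨ cong (_% q) (ℕ.+-comm (O w) (O′ w)) ⟩
      (O′ w ℕ.+ O w) % q       ∎))
    (λ bal w → ≡ᵐ-cancelʳ (I w) (O w) (O′ w) (begin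
      (I w ℕ.+ O′ w) % q       ≡⟨ eq w ⟩
      (I′ w ℕ.+ O w) % q       ≡⟨ ≡ᵐ-+ʳ (I′ w) (O′ w) (O w) (bal w) ⟩
      (O′ w ℕ.+ O w) % q       ≡⟨ cong (_% q) (ℕ.+-comm (O′ w) (O w)) ⟩
      (O w ℕ.+ O′ w) % q       ∎))
  flowCount-cong ((u , v) ∷ E) {I} {O} {I′} {O′} eq = sum-cong-≗ {p} (λ a → flowCount-cong E (λ w →
    let x = δ v w * suc (toℕ a)
        y = δ u w * suc (toℕ a)
    in begin
      (I w ℕ.+ x ℕ.+ (O′ w ℕ.+ y)) % q      ≡⟨ cong (_% q) (interchange (I w) x (O′ w) y) ⟩
      (I w ℕ.+ O′ w ℕ.+ (x ℕ.+ y)) % q      ≡⟨ ≡ᵐ-+ʳ (I w ℕ.+ O′ w) (I′ w ℕ.+ O w) (x ℕ.+ y) (eq w) ⟩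
      (I′ w ℕ.+ O w ℕ.+ (x ℕ.+ y)) % q      ≡⟨ cong (_% q) (interchange (I′ w) (O w) x y) ⟩
      (I′ w ℕ.+ x ℕ.+ (O w ℕ.+ y)) % q      ∎))

  flowCount-cong-≗ : ∀ {n m} (E : Edges n m) {I O I′ O′} → I ≗ I′ → O ≗ O′ → flowCount E I O ≡ flowCount E I′ O′
  flowCount-cong-≗ E I≗I′ O≗O′ = flowCount-cong E (λ w → cong₂ (λ i o → (i ℕ.+ o) % q) (I≗I′ w) (sym (O≗O′ w)))

  flowCount-push : ∀ {n m} {u v : Fin n} → u ≢ v → (E : Edges n m) → ∀ I O →
    flowCount (contractEdges u v E) (push u v I) (push u v O) ≡
    sum {q} (λ a → flowCount E (I ⊞ toℕ a · v) (O ⊞ toℕ a · u))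
  flowCount-push {u = u} {v} u≢v [] I O = sym (trans
    -- With no edges left, balance at `v` reads I v + a ≡ O v, because the edge leaves `u` and `u`
    -- differs from `v`. Its only solution is `d`.
    (sum-single {q} (λ a → 𝟙 (balanced? (I ⊞ toℕ a · v) (O ⊞ toℕ a · u))) d
      (λ a a≢d → 𝟙-false (balanced? (I ⊞ toℕ a · v) (O ⊞ toℕ a · u)) (λ bal → a≢d (difference-unique (O v) (I v) a (at-v a (bal v))))))
    (𝟙-cong (balanced? (I ⊞ toℕ d · v) (O ⊞ toℕ d · u)) (balanced? (push u v I) (push u v O)) to from))
    where
    d = difference (O v) (I v)
    ⊞-diag : ∀ (J : Fin _ → ℕ) a x → (J ⊞ a · x) x ≡ J x ℕ.+ a
    ⊞-diag J a x = cong (J x ℕ.+_) (trans (cong (ℕ._* a) (δ-diag x)) (ℕ.*-identityˡ a))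
    ⊞-off : ∀ (J : Fin _ → ℕ) a {x w} → x ≢ w → (J ⊞ a · x) w ≡ J w
    ⊞-off J a {x} {w} x≢w = trans (cong (λ e → J w ℕ.+ e * a) (δ-off x≢w)) (ℕ.+-identityʳ (J w))
    at-v : ∀ a → (I ⊞ toℕ a · v) v ≡ᵐ (O ⊞ toℕ a · u) v → I v ℕ.+ toℕ a ≡ᵐ O v
    at-v a eq = trans (cong (_% q) (sym (⊞-diag I (toℕ a) v))) (trans eq (cong (_% q) (⊞-off O (toℕ a) u≢v)))
    to : (∀ w → (I ⊞ toℕ d · v) w ≡ᵐ (O ⊞ toℕ d · u) w) → ∀ w → push u v I w ≡ᵐ push u v O w
    to bal w = cases (w Fin.≟ v) (w Fin.≟ u)
      where
      cases : Dec (w ≡ v) → Dec (w ≡ u) → push u v I w ≡ᵐ push u v O w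
      cases (yes refl) _ = cong (_% q) (trans (push-v u v I) (sym (push-v u v O)))
      cases (no w≢v) (no w≢u) = begin
        push u v I w % q             ≡⟨ cong (_% q) (trans (push-≢ w≢v w≢u I) (sym (⊞-off I (toℕ d) (w≢v ∘ sym)))) ⟩
        (I ⊞ toℕ d · v) w % q        ≡⟨ bal w ⟩
        (O ⊞ toℕ d · u) w % q        ≡⟨ cong (_% q) (trans (⊞-off O (toℕ d) (w≢u ∘ sym)) (sym (push-≢ w≢v w≢u O))) ⟩
        push u v O w % q             ∎
      cases (no _) (yes refl) = begin
        push u v I u % q                        ≡⟨ cong (_% q) (push-u u≢v I) ⟩
        (I u ℕ.+ I v) % q                       ≡⟨ cong (λ i → (i ℕ.+ I v) % q) (⊞-off I (toℕ d) (u≢v ∘ sym)) ⟨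
        -- Adding I v to both sides at `u` lets I v + d be traded for O v.
        ((I ⊞ toℕ d · v) u ℕ.+ I v) % q         ≡⟨ ≡ᵐ-+ʳ ((I ⊞ toℕ d · v) u) ((O ⊞ toℕ d · u) u) (I v) (bal u) ⟩
        ((O ⊞ toℕ d · u) u ℕ.+ I v) % q         ≡⟨ cong (λ o → (o ℕ.+ I v) % q) (⊞-diag O (toℕ d) u) ⟩
        (O u ℕ.+ toℕ d ℕ.+ I v) % q
          ≡⟨ cong (_% q) (trans (ℕ.+-assoc (O u) (toℕ d) (I v)) (cong (O u ℕ.+_) (ℕ.+-comm (toℕ d) (I v)))) ⟩
        (O u ℕ.+ (I v ℕ.+ toℕ d)) % q           ≡⟨ ≡ᵐ-+ˡ (O u) (I v ℕ.+ toℕ d) (O v) (+-difference (O v) (I v)) ⟩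
        (O u ℕ.+ O v) % q                       ≡⟨ cong (_% q) (push-u u≢v O) ⟨
        push u v O u % q                        ∎
    from : (∀ w → push u v I w ≡ᵐ push u v O w) → ∀ w → (I ⊞ toℕ d · v) w ≡ᵐ (O ⊞ toℕ d · u) w
    from bal w = cases (w Fin.≟ v) (w Fin.≟ u)
      where
      cases : Dec (w ≡ v) → Dec (w ≡ u) → (I ⊞ toℕ d · v) w ≡ᵐ (O ⊞ toℕ d · u) w
      cases (yes refl) _ = begin
        (I ⊞ toℕ d · v) v % q        ≡⟨ cong (_% q) (⊞-diag I (toℕ d) v) ⟩
        (I v ℕ.+ toℕ d) % q          ≡⟨ +-difference (O v) (I v) ⟩
        O v % q                      ≡⟨ cong (_% q) (⊞-off O (toℕ d) u≢v) ⟨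
        (O ⊞ toℕ d · u) v % q        ∎
      cases (no w≢v) (no w≢u) = begin
        (I ⊞ toℕ d · v) w % q        ≡⟨ cong (_% q) (trans (push-≢ w≢v w≢u I) (sym (⊞-off I (toℕ d) (w≢v ∘ sym)))) ⟨
        push u v I w % q             ≡⟨ bal w ⟩
        push u v O w % q             ≡⟨ cong (_% q) (trans (⊞-off O (toℕ d) (w≢u ∘ sym)) (sym (push-≢ w≢v w≢u O))) ⟨
        (O ⊞ toℕ d · u) w % q        ∎
      cases (no _) (yes refl) = ≡ᵐ-cancelʳ ((I ⊞ toℕ d · v) u) ((O ⊞ toℕ d · u) u) (I v) (begin
        ((I ⊞ toℕ d · v) u ℕ.+ I v) % q         ≡⟨ cong (λ i → (i ℕ.+ I v) % q) (⊞-off I (toℕ d) (u≢v ∘ sym)) ⟩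
        (I u ℕ.+ I v) % q                       ≡⟨ cong (_% q) (push-u u≢v I) ⟨
        push u v I u % q                        ≡⟨ bal u ⟩
        push u v O u % q                        ≡⟨ cong (_% q) (push-u u≢v O) ⟩
        (O u ℕ.+ O v) % q                       ≡⟨ ≡ᵐ-+ˡ (O u) (I v ℕ.+ toℕ d) (O v) (+-difference (O v) (I v)) ⟨
        (O u ℕ.+ (I v ℕ.+ toℕ d)) % q
          ≡⟨ cong (_% q) (trans (ℕ.+-assoc (O u) (toℕ d) (I v)) (cong (O u ℕ.+_) (ℕ.+-comm (toℕ d) (I v)))) ⟨
        (O u ℕ.+ toℕ d ℕ.+ I v) % q             ≡⟨ cong (λ o → (o ℕ.+ I v) % q) (⊞-diag O (toℕ d) u) ⟨
        ((O ⊞ toℕ d · u) u ℕ.+ I v) % q         ∎)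
  flowCount-push {u = u} {v} u≢v ((x , y) ∷ E) I O = begin
    sum {p} (λ b → flowCount (contractEdges u v E) (push u v I ⊞ suc (toℕ b) · contract u v y) (push u v O ⊞ suc (toℕ b) · contract u v x))
      ≡⟨ sum-cong-≗ {p} (λ b → flowCount-cong-≗ (contractEdges u v E)
           (push-⊞ u≢v I (suc (toℕ b)) y) (push-⊞ u≢v O (suc (toℕ b)) x)) ⟨
    sum {p} (λ b → flowCount (contractEdges u v E) (push u v (I ⊞ suc (toℕ b) · y)) (push u v (O ⊞ suc (toℕ b) · x)))
      ≡⟨ sum-cong-≗ {p} (λ b → flowCount-push u≢v E (I ⊞ suc (toℕ b) · y) (O ⊞ suc (toℕ b) · x)) ⟩
    sum {p} (λ b → sum {q} (λ a → flowCount E (I ⊞ suc (toℕ b) · y ⊞ toℕ a · v) (O ⊞ suc (toℕ b) · x ⊞ toℕ a · u)))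
      -- The value on (u , v) is to be fixed before that on (x , y), as `flowCount` of the longer
      -- list with demand a prescribes.
      ≡⟨ ∑-comm {p} {q} (λ b a → flowCount E (I ⊞ suc (toℕ b) · y ⊞ toℕ a · v) (O ⊞ suc (toℕ b) · x ⊞ toℕ a · u)) ⟩
    sum {q} (λ a → sum {p} (λ b → flowCount E (I ⊞ suc (toℕ b) · y ⊞ toℕ a · v) (O ⊞ suc (toℕ b) · x ⊞ toℕ a · u)))
      ≡⟨ sum-cong-≗ {q} (λ a → sum-cong-≗ {p} (λ b → flowCount-cong-≗ E (⊞-comm I (suc (toℕ b)) y (toℕ a) v) (⊞-comm O (suc (toℕ b)) x (toℕ a) u))) ⟩
    sum {q} (λ a → flowCount ((x , y) ∷ E) (I ⊞ toℕ a · v) (O ⊞ toℕ a · u)) ∎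
    where
    ⊞-comm : ∀ {n} (J : Fin n → ℕ) b x a y → (J ⊞ b · x ⊞ a · y) ≗ (J ⊞ a · y ⊞ b · x)
    ⊞-comm J b x a y w = xy∙z≈xz∙y (J w) (δ x w * b) (δ y w * a)

-- Deletion and contraction

zero-demand : ∀ {n} → Fin n → ℕ
zero-demand _ = 0

flows : ∀ p {n m} → Edges n m → ℚ
flows p E = flowCount p E zero-demand zero-demand

flows-[] : ∀ p {n} → flows p {n} [] ≡ 1ℚ
flows-[] p {n} = 𝟙-true (balanced? p {n} zero-demand zero-demand) (λ _ → refl)

flows-loop : ∀ p {n m} (E : Edges n m) u → flows p ((u , u) ∷ E) ≡ ι p ℚ.* flows p E
flows-loop p E u = trans
  (sum-cong-≗ {p} (λ a → flowCount-cong p E (λ w → cong (_% suc p) (ℕ.+-identityʳ (δ u w * suc (toℕ a))))))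
  (sum-const p (flows p E))

-- Of the q residues in `flowCount-push`, the residue 0 gives the flows of the deletion and the
-- remaining p give the nowhere-zero flows with the edge present.
flows-link : ∀ p {n m} (E : Edges n m) {u v} → u ≢ v → flows p ((u , v) ∷ E) ≡ flows p (contractEdges u v E) ℚ.- flows p E
flows-link p E {u} {v} u≢v = sym (begin
  flows p (contractEdges u v E) ℚ.- flows p E
    ≡⟨ cong (ℚ._- flows p E) (flowCount-cong-≗ p (contractEdges u v E) push-zero push-zero) ⟨
  flowCount p (contractEdges u v E) (push u v zero-demand) (push u v zero-demand) ℚ.- flows p E
    ≡⟨ cong (ℚ._- flows p E) (flowCount-push p u≢v E zero-demand zero-demand) ⟩
  flowCount p E (zero-demand ⊞ 0 · v) (zero-demand ⊞ 0 · u) ℚ.+ flows p ((u , v) ∷ E) ℚ.- flows p E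
    ≡⟨ cong (λ s → s ℚ.+ flows p ((u , v) ∷ E) ℚ.- flows p E) (flowCount-cong-≗ p E (λ w → ℕ.*-zeroʳ (δ v w)) (λ w → ℕ.*-zeroʳ (δ u w))) ⟩
  flows p E ℚ.+ flows p ((u , v) ∷ E) ℚ.- flows p E
    ≡⟨ solve 2 (λ s t → s :+ t :- s := t) refl (flows p E) (flows p ((u , v) ∷ E)) ⟩
  flows p ((u , v) ∷ E) ∎)
  where
  push-zero : push u v zero-demand ≗ zero-demand
  push-zero w with w Fin.≟ v | w Fin.≟ u
  ... | yes _ | _     = refl
  ... | no _  | yes _ = refl
  ... | no _  | no _  = refl

ι-pred : ∀ p → ι p ≡ ι (suc p) ℚ.- 1ℚ
ι-pred p = trans
  (solve 1 (λ x → x := con 1ℚ :+ x :- con 1ℚ) refl (ι p))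
  (cong (ℚ._- 1ℚ) (sym (ι-suc p)))

-- Witness for the existence of a flow polynomial. The recursion runs on the number `m` of edges,
-- since contracted edges are not a subterm of the given ones.
flowPoly : ∀ {n} m → Edges n m → Poly
flowPoly zero    []            = 1ₚ
flowPoly (suc m) ((u , v) ∷ E) with u Fin.≟ v
... | yes _ = (X -ₚ 1ₚ) *ₚ flowPoly m E
... | no  _ = flowPoly m (contractEdges u v E) -ₚ flowPoly m E

eval-flowPoly : ∀ p {n} m (E : Edges n m) → eval (flowPoly m E) (ι (suc p)) ≡ flows p E
eval-flowPoly p {n} zero []            = trans (eval-C (ι (suc p)) 1ℚ) (sym (flows-[] p {n}))
eval-flowPoly p (suc m) ((u , v) ∷ E) with u Fin.≟ v
... | yes refl = begin
  eval ((X -ₚ 1ₚ) *ₚ flowPoly m E) r             ≡⟨ eval-* r (X -ₚ 1ₚ) (flowPoly m E) ⟩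
  eval (X -ₚ 1ₚ) r ℚ.* eval (flowPoly m E) r     ≡⟨ cong₂ ℚ._*_ eval-X-1 (eval-flowPoly p m E) ⟩
  ι p ℚ.* flows p E                              ≡⟨ flows-loop p E u ⟨
  flows p ((u , u) ∷ E)                          ∎
  where
  r = ι (suc p)
  eval-X-1 : eval (X -ₚ 1ₚ) r ≡ ι p
  eval-X-1 = trans (eval-∸ r X 1ₚ) (trans (cong₂ ℚ._-_ (eval-X r) (eval-C r 1ℚ)) (sym (ι-pred p)))
... | no u≢v = begin
  eval (flowPoly m (contractEdges u v E) -ₚ flowPoly m E) r
    ≡⟨ eval-∸ r (flowPoly m (contractEdges u v E)) (flowPoly m E) ⟩
  eval (flowPoly m (contractEdges u v E)) r ℚ.- eval (flowPoly m E) r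
    ≡⟨ cong₂ ℚ._-_ (eval-flowPoly p m (contractEdges u v E)) (eval-flowPoly p m E) ⟩
  flows p (contractEdges u v E) ℚ.- flows p E
    ≡⟨ flows-link p E u≢v ⟨
  flows p ((u , v) ∷ E) ∎
  where r = ι (suc p)

-- Weighted sums over colourings

∑Vec-const : ∀ {q} n → ∑Vec {q} n (λ _ → 1ℚ) ≡ ι q ^ n
∑Vec-const zero    = refl
∑Vec-const {q} (suc n) = trans (sum-const q (∑Vec n (λ _ → 1ℚ))) (cong (ι q ℚ.*_) (∑Vec-const n))

∑Vec-sum : ∀ {q k} n (f : Fin k → Vec (Fin q) n → ℚ) → ∑Vec n (λ θ → sum (λ a → f a θ)) ≡ sum (λ a → ∑Vec n (f a))
∑Vec-sum zero    f = refl
∑Vec-sum {q} {k} (suc n) f = trans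
  (sum-cong-≗ (λ c → ∑Vec-sum n (λ a θ → f a (c ∷ θ))))
  (∑-comm {q} {k} (λ c a → ∑Vec n (λ θ → f a (c ∷ θ))))

-- Each colouring arises q times as θ [ v ]≔ a, once for every former colour of `v`.
∑Vec-resample : ∀ {q n} (v : Fin n) (f : Vec (Fin q) n → ℚ) →
  ∑Vec n (λ θ → sum (λ a → f (θ [ v ]≔ a))) ≡ ι q ℚ.* ∑Vec n f
∑Vec-resample {q} {suc n} zero f = begin
  sum {q} (λ _ → ∑Vec n (λ θ → sum (λ a → f (a ∷ θ))))     ≡⟨ sum-const q _ ⟩
  ι q ℚ.* ∑Vec n (λ θ → sum (λ a → f (a ∷ θ)))             ≡⟨ cong (ι q ℚ.*_) (∑Vec-sum n (λ a θ → f (a ∷ θ))) ⟩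
  ι q ℚ.* ∑Vec (suc n) f                                   ∎
∑Vec-resample {q} {suc n} (suc v) f = trans
  (sum-cong-≗ (λ c → ∑Vec-resample v (λ θ → f (c ∷ θ))))
  (sym (*-distribˡ-sum (ι q) (λ c → ∑Vec n (λ θ → f (c ∷ θ)))))

module _ {q : ℕ} where

  -- This is the sum of ω^(k (c - d)) over the nonzero residues k, for a primitive q-th root of
  -- unity ω: the Fourier transform of the nowhere-zero condition on one edge. Expanding the balance
  -- conditions in characters leads to the same colouring sum.
  edgeWeight : Fin q → Fin q → ℚ
  edgeWeight c d = ι q ℚ.* 𝟙 (c Fin.≟ d) ℚ.- 1ℚ

  colouringWeight : ∀ {n m} → Edges n m → Vec (Fin q) n → ℚ
  colouringWeight []            θ = 1ℚ
  colouringWeight ((u , v) ∷ E) θ = edgeWeight (Vec.lookup θ u) (Vec.lookup θ v) ℚ.* colouringWeight E θ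

  lookup-contract : ∀ {n} (θ : Vec (Fin q) n) u v x →
    Vec.lookup (θ [ v ]≔ Vec.lookup θ u) x ≡ Vec.lookup θ (contract u v x)
  lookup-contract θ u v x with contract-cases u v x
  ... | inj₁ (refl , eq) = trans (Vec.lookup∘update x θ (Vec.lookup θ u)) (cong (Vec.lookup θ) (sym eq))
  ... | inj₂ (x≢v , eq)  = trans (Vec.lookup∘update′ x≢v θ (Vec.lookup θ u)) (cong (Vec.lookup θ) (sym eq))

  colouringWeight-contract : ∀ {n m} (E : Edges n m) u v θ →
    colouringWeight E (θ [ v ]≔ Vec.lookup θ u) ≡ colouringWeight (contractEdges u v E) θ
  colouringWeight-contract []            u v θ = refl
  colouringWeight-contract ((x , y) ∷ E) u v θ = cong₂ ℚ._*_
    (cong₂ edgeWeight (lookup-contract θ u v x) (lookup-contract θ u v y))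
    (colouringWeight-contract E u v θ)

  ∑colourings : ∀ {n m} → Edges n m → ℚ
  ∑colourings {n} E = ∑Vec n (colouringWeight E)

  -- The factor q is spent on recolouring `v`: the indicator keeps only the recolouring that copies
  -- the colour of `u`, and that weight is the one of the contracted edges, where the original
  -- colour of `v` is free.
  ∑colourings-contract : ∀ {n m} (E : Edges n m) {u v} → u ≢ v →
    ι q ℚ.* ∑Vec n (λ θ → 𝟙 (Vec.lookup θ u Fin.≟ Vec.lookup θ v) ℚ.* colouringWeight E θ) ≡ ∑colourings (contractEdges u v E)
  ∑colourings-contract {n} E {u} {v} u≢v = trans (sym (∑Vec-resample v G)) (∑Vec-cong n (λ θ → begin
    sum (λ a → G (θ [ v ]≔ a))
      ≡⟨ sum-single (λ a → G (θ [ v ]≔ a)) (Vec.lookup θ u) (λ a a≢θu → trans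
           (cong (ℚ._* colouringWeight E (θ [ v ]≔ a)) (𝟙-false (_ Fin.≟ _) (λ eq → a≢θu (sym (at-uv θ a eq)))))
           (ℚ.*-zeroˡ (colouringWeight E (θ [ v ]≔ a)))) ⟩
    G (θ [ v ]≔ Vec.lookup θ u)
      ≡⟨ cong (ℚ._* colouringWeight E (θ [ v ]≔ Vec.lookup θ u)) (𝟙-true (_ Fin.≟ _)
           (trans (Vec.lookup∘update′ u≢v θ _) (sym (Vec.lookup∘update v θ _)))) ⟩
    1ℚ ℚ.* colouringWeight E (θ [ v ]≔ Vec.lookup θ u)
      ≡⟨ ℚ.*-identityˡ _ ⟩
    colouringWeight E (θ [ v ]≔ Vec.lookup θ u)
      ≡⟨ colouringWeight-contract E u v θ ⟩
    colouringWeight (contractEdges u v E) θ ∎))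
    where
    G : Vec (Fin q) n → ℚ
    G θ = 𝟙 (Vec.lookup θ u Fin.≟ Vec.lookup θ v) ℚ.* colouringWeight E θ
    at-uv : ∀ θ a → Vec.lookup (θ [ v ]≔ a) u ≡ Vec.lookup (θ [ v ]≔ a) v → Vec.lookup θ u ≡ a
    at-uv θ a eq = trans (sym (Vec.lookup∘update′ u≢v θ a)) (trans eq (Vec.lookup∘update v θ a))

  ∑colourings-link : ∀ {n m} (E : Edges n m) {u v} → u ≢ v →
    ∑colourings ((u , v) ∷ E) ≡ ∑colourings (contractEdges u v E) ℚ.- ∑colourings E
  ∑colourings-link {n} E {u} {v} u≢v = begin
    ∑Vec n (λ θ → (ι q ℚ.* e θ ℚ.- 1ℚ) ℚ.* w θ)
      ≡⟨ ∑Vec-cong n (λ θ → solve 3 (λ q e w → (q :* e :- con 1ℚ) :* w := q :* (e :* w) :+ (:- con 1ℚ) :* w) refl (ι q) (e θ) (w θ)) ⟩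
    ∑Vec n (λ θ → ι q ℚ.* (e θ ℚ.* w θ) ℚ.+ (ℚ.- 1ℚ) ℚ.* w θ)
      ≡⟨ ∑Vec-+ n (λ θ → ι q ℚ.* (e θ ℚ.* w θ)) (λ θ → (ℚ.- 1ℚ) ℚ.* w θ) ⟩
    ∑Vec n (λ θ → ι q ℚ.* (e θ ℚ.* w θ)) ℚ.+ ∑Vec n (λ θ → (ℚ.- 1ℚ) ℚ.* w θ)
      ≡⟨ cong₂ ℚ._+_ (trans (∑Vec-scale n (ι q) (λ θ → e θ ℚ.* w θ)) (∑colourings-contract E u≢v)) (∑Vec-scale n (ℚ.- 1ℚ) w) ⟩
    ∑colourings (contractEdges u v E) ℚ.+ (ℚ.- 1ℚ) ℚ.* ∑colourings E
      ≡⟨ solve 2 (λ s t → s :+ (:- con 1ℚ) :* t := s :- t) refl (∑colourings (contractEdges u v E)) (∑colourings E) ⟩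
    ∑colourings (contractEdges u v E) ℚ.- ∑colourings E ∎
    where
    e w : Vec (Fin q) n → ℚ
    e θ = 𝟙 (Vec.lookup θ u Fin.≟ Vec.lookup θ v)
    w = colouringWeight E

flows≡∑colourings : ∀ p {n} m (E : Edges n m) → ι (suc p) ^ n ℚ.* flows p E ≡ ∑colourings {suc p} E
flows≡∑colourings p {n} zero [] = begin
  ι (suc p) ^ n ℚ.* flows p {n} []     ≡⟨ cong (ι (suc p) ^ n ℚ.*_) (flows-[] p {n}) ⟩
  ι (suc p) ^ n ℚ.* 1ℚ                 ≡⟨ ℚ.*-identityʳ _ ⟩
  ι (suc p) ^ n                        ≡⟨ ∑Vec-const n ⟨
  ∑colourings {suc p} {n} []           ∎
flows≡∑colourings p {n} (suc m) ((u , v) ∷ E) with u Fin.≟ v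
... | yes refl = begin
  ι q ^ n ℚ.* flows p ((u , u) ∷ E)         ≡⟨ cong (ι q ^ n ℚ.*_) (flows-loop p E u) ⟩
  ι q ^ n ℚ.* (ι p ℚ.* flows p E)           ≡⟨ solve 3 (λ a b c → a :* (b :* c) := b :* (a :* c)) refl (ι q ^ n) (ι p) (flows p E) ⟩
  ι p ℚ.* (ι q ^ n ℚ.* flows p E)           ≡⟨ cong (ι p ℚ.*_) (flows≡∑colourings p m E) ⟩
  ι p ℚ.* ∑colourings E                     ≡⟨ ∑Vec-scale n (ι p) (colouringWeight E) ⟨
  ∑Vec n (λ θ → ι p ℚ.* colouringWeight E θ)
    ≡⟨ ∑Vec-cong n (λ θ → cong (ℚ._* colouringWeight E θ) (loop-weight (Vec.lookup θ u))) ⟨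
  ∑colourings ((u , u) ∷ E)                 ∎
  where
  q = suc p
  loop-weight : ∀ c → edgeWeight c c ≡ ι p
  loop-weight c = begin
    ι q ℚ.* 𝟙 (c Fin.≟ c) ℚ.- 1ℚ     ≡⟨ cong (λ e → ι q ℚ.* e ℚ.- 1ℚ) (𝟙-true (c Fin.≟ c) refl) ⟩
    ι q ℚ.* 1ℚ ℚ.- 1ℚ                ≡⟨ cong (ℚ._- 1ℚ) (ℚ.*-identityʳ (ι q)) ⟩
    ι q ℚ.- 1ℚ                       ≡⟨ ι-pred p ⟨
    ι p                              ∎
... | no u≢v = begin
  Q ℚ.* flows p ((u , v) ∷ E)                                      ≡⟨ cong (Q ℚ.*_) (flows-link p E u≢v) ⟩
  Q ℚ.* (flows p (contractEdges u v E) ℚ.- flows p E)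
    ≡⟨ solve 3 (λ a b c → a :* (b :- c) := a :* b :- a :* c) refl Q (flows p (contractEdges u v E)) (flows p E) ⟩
  Q ℚ.* flows p (contractEdges u v E) ℚ.- Q ℚ.* flows p E
    ≡⟨ cong₂ ℚ._-_ (flows≡∑colourings p m (contractEdges u v E)) (flows≡∑colourings p m E) ⟩
  ∑colourings (contractEdges u v E) ℚ.- ∑colourings E              ≡⟨ ∑colourings-link E u≢v ⟨
  ∑colourings ((u , v) ∷ E)                                        ∎
  where Q = ι (suc p) ^ n

-- From lists of edges and assignments to indexed sums and products

module FoldMap (_∙_ : ℚ → ℚ → ℚ) (ε : ℚ) (∙-identityˡ : ∀ x → ε ∙ x ≡ x)
  (∙-assoc : ∀ x y z → (x ∙ y) ∙ z ≡ x ∙ (y ∙ z)) where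

  foldMap : ∀ {A : Set} → (A → ℚ) → List A → ℚ
  foldMap f []       = ε
  foldMap f (x ∷ xs) = f x ∙ foldMap f xs

  foldMap-cong : ∀ {A : Set} {f g : A → ℚ} → f ≗ g → ∀ xs → foldMap f xs ≡ foldMap g xs
  foldMap-cong f≗g []       = refl
  foldMap-cong f≗g (x ∷ xs) = cong₂ _∙_ (f≗g x) (foldMap-cong f≗g xs)

  foldMap-++ : ∀ {A : Set} (f : A → ℚ) xs ys → foldMap f (xs List.++ ys) ≡ foldMap f xs ∙ foldMap f ys
  foldMap-++ f []       ys = sym (∙-identityˡ _)
  foldMap-++ f (x ∷ xs) ys = trans (cong (f x ∙_) (foldMap-++ f xs ys)) (sym (∙-assoc (f x) _ _))

  foldMap-map : ∀ {A B : Set} (f : B → ℚ) (g : A → B) xs → foldMap f (List.map g xs) ≡ foldMap (f ∘ g) xs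
  foldMap-map f g []       = refl
  foldMap-map f g (x ∷ xs) = cong (f (g x) ∙_) (foldMap-map f g xs)

  foldMap-tabulate : ∀ {A : Set} {n} (f : A → ℚ) (g : Fin n → A) → foldMap f (List.tabulate g) ≡ Functional.foldr _∙_ ε (f ∘ g)
  foldMap-tabulate {n = zero}  f g = refl
  foldMap-tabulate {n = suc n} f g = cong (f (g zero) ∙_) (foldMap-tabulate f (g ∘ suc))

  foldMap-cartesianProductWith : ∀ {A B C : Set} (f : C → ℚ) (_⊗_ : A → B → C) xs ys →
    foldMap f (List.cartesianProductWith _⊗_ xs ys) ≡ foldMap (λ x → foldMap (λ y → f (x ⊗ y)) ys) xs
  foldMap-cartesianProductWith f _⊗_ []       ys = refl
  foldMap-cartesianProductWith f _⊗_ (x ∷ xs) ys = trans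
    (foldMap-++ f (List.map (x ⊗_) ys) _)
    (cong₂ _∙_ (foldMap-map f (x ⊗_) ys) (foldMap-cartesianProductWith f _⊗_ xs ys))

open FoldMap ℚ._+_ 0ℚ ℚ.+-identityˡ ℚ.+-assoc
  renaming (foldMap to ∑List; foldMap-tabulate to ∑List-tabulate; foldMap-cartesianProductWith to ∑List-cartesianProductWith)
  using ()
open FoldMap ℚ._*_ 1ℚ ℚ.*-identityˡ ℚ.*-assoc
  renaming (foldMap to ∏List; foldMap-cong to ∏List-cong; foldMap-tabulate to ∏List-tabulate; foldMap-cartesianProductWith to ∏List-cartesianProductWith)
  using ()

∑List-allVecs : ∀ q m (f : Vec (Fin q) m → ℚ) → ∑List f (allVecs q m) ≡ ∑Vec m f
∑List-allVecs q zero    f = ℚ.+-identityʳ (f [])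
∑List-allVecs q (suc m) f = begin
  ∑List f (allVecs q (suc m))
    ≡⟨ ∑List-cartesianProductWith f _∷_ (List.allFin q) (allVecs q m) ⟩
  ∑List (λ c → ∑List (λ θ → f (c ∷ θ)) (allVecs q m)) (List.allFin q)
    ≡⟨ ∑List-tabulate {n = q} _ (λ c → c) ⟩
  sum (λ c → ∑List (λ θ → f (c ∷ θ)) (allVecs q m))
    ≡⟨ sum-cong-≗ (λ c → ∑List-allVecs q m (λ θ → f (c ∷ θ))) ⟩
  ∑Vec (suc m) f ∎

length-filter : ∀ {A : Set} {P : A → Set} (P? : ∀ x → Dec (P x)) xs → ι (List.length (List.filter P? xs)) ≡ ∑List (𝟙 ∘ P?) xs
length-filter P? []       = refl
length-filter P? (x ∷ xs) with P? x
... | yes _ = trans (ι-suc (List.length (List.filter P? xs))) (cong (1ℚ ℚ.+_) (length-filter P? xs))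
... | no  _ = trans (length-filter P? xs) (sym (ℚ.+-identityˡ _))

module _ (p : ℕ) {n : ℕ} where

  private
    q = suc p
    V = Fin n

  -- Removing the first edge changes inflow and outflow at its ends, and the demands take up the
  -- change. For zero demands the condition unfolds to `IsNowhereZeroFlow`.
  IsFlowWithDemand : (es : List (V × V)) → (I O : V → ℕ) → Vec (Fin q) (List.length es) → Set
  IsFlowWithDemand es I O k =
    (∀ e → toℕ (Vec.lookup k e) ≢ 0) × (∀ v → (I v ℕ.+ inflow (graph n es) q k v) % q ≡ (O v ℕ.+ outflow (graph n es) q k v) % q)

  isFlowWithDemand? : ∀ es I O k → Dec (IsFlowWithDemand es I O k)
  isFlowWithDemand? es I O k = FinP.all? (λ e → ¬? (toℕ (Vec.lookup k e) ℕ.≟ 0)) ×-dec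
    FinP.all? (λ v → (I v ℕ.+ inflow (graph n es) q k v) % q ℕ.≟ (O v ℕ.+ outflow (graph n es) q k v) % q)

  inflow-∷ : ∀ e es a k v → inflow (graph n (e ∷ es)) q (a ∷ k) v ≡ δ (proj₂ e) v * toℕ a ℕ.+ inflow (graph n es) q k v
  inflow-∷ e es a k v = cong (λ xs → δ (proj₂ e) v * toℕ a ℕ.+ sumℕ xs)
    (trans (List.map-tabulate {n = List.length es} suc _) (sym (List.map-tabulate (λ i → i) _)))

  outflow-∷ : ∀ e es a k v → outflow (graph n (e ∷ es)) q (a ∷ k) v ≡ δ (proj₁ e) v * toℕ a ℕ.+ outflow (graph n es) q k v
  outflow-∷ e es a k v = cong (λ xs → δ (proj₁ e) v * toℕ a ℕ.+ sumℕ xs)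
    (trans (List.map-tabulate {n = List.length es} suc _) (sym (List.map-tabulate (λ i → i) _)))

  flowCount-fromList : ∀ es I O →
    flowCount p (Vec.fromList es) I O ≡ ∑Vec (List.length es) (λ k → 𝟙 (isFlowWithDemand? es I O k))
  flowCount-fromList [] I O = 𝟙-cong (balanced? p I O) (isFlowWithDemand? [] I O [])
    (λ bal → (λ ()) , (λ v → trans (+-0 (I v)) (trans (bal v) (sym (+-0 (O v))))))
    (λ (_ , bal) v → trans (sym (+-0 (I v))) (trans (bal v) (+-0 (O v))))
    where
    +-0 : ∀ a → (a ℕ.+ 0) % q ≡ a % q
    +-0 a = cong (_% q) (ℕ.+-identityʳ a)
  flowCount-fromList ((u , v) ∷ es) I O = begin
    sum {p} (λ a → flowCount p (Vec.fromList es) (I ⊞ suc (toℕ a) · v) (O ⊞ suc (toℕ a) · u))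
      ≡⟨ sum-cong-≗ {p} (λ a → flowCount-fromList es (I ⊞ suc (toℕ a) · v) (O ⊞ suc (toℕ a) · u)) ⟩
    sum {p} (λ a → ∑Vec m (λ k → 𝟙 (isFlowWithDemand? es (I ⊞ suc (toℕ a) · v) (O ⊞ suc (toℕ a) · u) k)))
      ≡⟨ sum-cong-≗ {p} (λ a → ∑Vec-cong m (λ k →
           𝟙-cong (isFlowWithDemand? es (I ⊞ suc (toℕ a) · v) (O ⊞ suc (toℕ a) · u) k) (isFlowWithDemand? ((u , v) ∷ es) I O (suc a ∷ k))
             (λ (nz , bal) → (λ { zero () ; (suc e) → nz e }) , λ w → trans (sym (in-eq a k w)) (trans (bal w) (out-eq a k w)))
             (λ (nz , bal) → nz ∘ suc , λ w → trans (in-eq a k w) (trans (bal w) (sym (out-eq a k w)))))) ⟩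
    S
      ≡⟨ ℚ.+-identityˡ S ⟨
    0ℚ ℚ.+ S
      -- The value `zero` on the first edge is never nowhere-zero; what remains are the residues
      -- `suc a` over which `flowCount` sums.
      ≡⟨ cong (ℚ._+ S) (trans (∑Vec-cong m (λ k → 𝟙-false (isFlowWithDemand? ((u , v) ∷ es) I O (zero ∷ k)) (λ (nz , _) → nz zero refl))) (∑Vec-zero m)) ⟨
    ∑Vec (suc m) (λ k → 𝟙 (isFlowWithDemand? ((u , v) ∷ es) I O k)) ∎
    where
    m = List.length es
    S = sum {p} (λ a → ∑Vec m (λ k → 𝟙 (isFlowWithDemand? ((u , v) ∷ es) I O (suc a ∷ k))))
    ∑Vec-zero : ∀ m → ∑Vec {q} m (λ _ → 0ℚ) ≡ 0ℚ
    ∑Vec-zero m = trans (∑Vec-scale {q} m 0ℚ (λ _ → 0ℚ)) (ℚ.*-zeroˡ (∑Vec {q} m (λ _ → 0ℚ)))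
    in-eq : ∀ a k w → ((I ⊞ suc (toℕ a) · v) w ℕ.+ inflow (graph n es) q k w) % q ≡
      (I w ℕ.+ inflow (graph n ((u , v) ∷ es)) q (suc a ∷ k) w) % q
    in-eq a k w = cong (_% q) (trans (ℕ.+-assoc (I w) (δ v w * suc (toℕ a)) _) (cong (I w ℕ.+_) (sym (inflow-∷ (u , v) es (suc a) k w))))
    out-eq : ∀ a k w → ((O ⊞ suc (toℕ a) · u) w ℕ.+ outflow (graph n es) q k w) % q ≡
      (O w ℕ.+ outflow (graph n ((u , v) ∷ es)) q (suc a ∷ k) w) % q
    out-eq a k w = cong (_% q) (trans (ℕ.+-assoc (O w) (δ u w * suc (toℕ a)) _) (cong (O w ℕ.+_) (sym (outflow-∷ (u , v) es (suc a) k w))))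

  #nowhereZeroFlows≡flows : ∀ es → ι (#nowhereZeroFlows (graph n es) q) ≡ flows p (Vec.fromList es)
  #nowhereZeroFlows≡flows es = begin
    ι (#nowhereZeroFlows (graph n es) q)
      ≡⟨ length-filter (isNowhereZeroFlow? (graph n es) q) (allVecs q (List.length es)) ⟩
    ∑List (𝟙 ∘ isNowhereZeroFlow? (graph n es) q) (allVecs q (List.length es))
      ≡⟨ ∑List-allVecs q (List.length es) _ ⟩
    ∑Vec (List.length es) (𝟙 ∘ isNowhereZeroFlow? (graph n es) q)
      ≡⟨ ∑Vec-cong (List.length es) (λ k → 𝟙-cong (isNowhereZeroFlow? (graph n es) q k) (isFlowWithDemand? es zero-demand zero-demand k) (λ f → f) (λ f → f)) ⟩
    ∑Vec (List.length es) (λ k → 𝟙 (isFlowWithDemand? es zero-demand zero-demand k))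
      ≡⟨ flowCount-fromList es zero-demand zero-demand ⟨
    flows p (Vec.fromList es) ∎

-- The complete graph

ifDec : ∀ {P : Set} → Dec P → ℚ → ℚ
ifDec (yes _) x = x
ifDec (no  _) x = 1ℚ

ifDec-cong : ∀ {P Q : Set} (P? : Dec P) (Q? : Dec Q) → (P → Q) → (Q → P) → ∀ x → ifDec P? x ≡ ifDec Q? x
ifDec-cong (yes _) (yes _) _ _ x = refl
ifDec-cong (no _)  (no _)  _ _ x = refl
ifDec-cong (yes p) (no ¬q) f _ x = contradiction (f p) ¬q
ifDec-cong (no ¬p) (yes q) _ g x = contradiction (g q) ¬p

ifDec-false : ∀ {P : Set} (P? : Dec P) → ¬ P → ∀ x → ifDec P? x ≡ 1ℚ
ifDec-false P? ¬p = ifDec-cong P? (no ¬p) (λ p → p) (λ p → p)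

ifDec-true : ∀ {P : Set} (P? : Dec P) → P → ∀ x → ifDec P? x ≡ x
ifDec-true P? p = ifDec-cong P? (yes p) (λ p → p) (λ p → p)

∏List-filter : ∀ {A : Set} {P : A → Set} (P? : ∀ x → Dec (P x)) f xs →
  ∏List f (List.filter P? xs) ≡ ∏List (λ x → ifDec (P? x) (f x)) xs
∏List-filter P? f []       = refl
∏List-filter P? f (x ∷ xs) with P? x
... | yes _ = cong (f x ℚ.*_) (∏List-filter P? f xs)
... | no  _ = trans (∏List-filter P? f xs) (sym (ℚ.*-identityˡ _))

module _ {q : ℕ} where

  edgeWeight² : ∀ {n} → Vec (Fin q) n → Fin n × Fin n → ℚ
  edgeWeight² θ (u , v) = edgeWeight (Vec.lookup θ u) (Vec.lookup θ v)

  colouringWeight-fromList : ∀ {n} (es : List (Fin n × Fin n)) θ → colouringWeight (Vec.fromList es) θ ≡ ∏List (edgeWeight² θ) es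
  colouringWeight-fromList []             θ = refl
  colouringWeight-fromList ((u , v) ∷ es) θ = cong (edgeWeight² θ (u , v) ℚ.*_) (colouringWeight-fromList es θ)

  -- The product runs over the full square of ordered pairs, with factor 1 unless u < v, so that
  -- splitting off vertex `zero` reproduces the same shape on the rest.
  completeWeight : ∀ {n} → Vec (Fin q) n → ℚ
  completeWeight {n} θ = product {n} (λ u → product {n} (λ v → ifDec (u Fin.<? v) (edgeWeight² θ (u , v))))

  colouringWeight-complete : ∀ n θ → colouringWeight (Vec.fromList (Graph.edges (complete n))) θ ≡ completeWeight θ
  colouringWeight-complete n θ = begin
    colouringWeight (Vec.fromList (Graph.edges (complete n))) θ
      ≡⟨ colouringWeight-fromList (Graph.edges (complete n)) θ ⟩
    ∏List (edgeWeight² θ) (Graph.edges (complete n))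
      ≡⟨ ∏List-filter (λ (u , v) → u Fin.<? v) (edgeWeight² θ) (List.cartesianProduct Vs Vs) ⟩
    ∏List (λ e → w (proj₁ e) (proj₂ e)) (List.cartesianProduct Vs Vs)
      ≡⟨ ∏List-cartesianProductWith (λ e → w (proj₁ e) (proj₂ e)) _,_ Vs Vs ⟩
    ∏List (λ u → ∏List (λ v → w u v) Vs) Vs
      ≡⟨ ∏List-cong (λ u → ∏List-tabulate {n = n} (w u) (λ v → v)) Vs ⟩
    ∏List (λ u → product {n} (w u)) Vs
      ≡⟨ ∏List-tabulate {n = n} (λ u → product {n} (w u)) (λ v → v) ⟩
    completeWeight θ ∎
    where
    Vs = List.allFin n
    w : Fin n → Fin n → ℚ
    w u v = ifDec (u Fin.<? v) (edgeWeight² θ (u , v))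

  completeWeight-∷ : ∀ {n} c (θ : Vec (Fin q) n) →
    completeWeight (c ∷ θ) ≡ product {n} (λ v → edgeWeight c (Vec.lookup θ v)) ℚ.* completeWeight θ
  completeWeight-∷ {n} c θ = cong₂ ℚ._*_
    (trans (cong₂ ℚ._*_ (ifDec-false (Fin.zero {n} Fin.<? Fin.zero {n}) (λ ()) (edgeWeight c c))
             (product-cong {n} (λ v → ifDec-true (Fin.zero {n} Fin.<? Fin.suc v) (ℕ.s≤s ℕ.z≤n) (edgeWeight c (Vec.lookup θ v)))))
           (ℚ.*-identityˡ (product {n} (λ v → edgeWeight c (Vec.lookup θ v)))))
    (product-cong {n} (λ u → trans (cong₂ ℚ._*_
      (ifDec-false (Fin.suc u Fin.<? Fin.zero {n}) (λ ()) (edgeWeight (Vec.lookup θ u) c))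
      (product-cong {n} (λ v → ifDec-cong (Fin.suc u Fin.<? Fin.suc v) (u Fin.<? v) ℕ.s≤s⁻¹ ℕ.s≤s (edgeWeight² θ (u , v)))))
      (ℚ.*-identityˡ _)))

  -- The weight of the equally coloured pairs between the vertices of θ and those already recorded
  -- in `ms`.
  countWeight : ∀ {n} → ℚ → Vec ℕ q → Vec (Fin q) n → ℚ
  countWeight {n} y ms θ = product {n} (λ v → y ^ Vec.lookup ms (Vec.lookup θ v))

  private
    y = 1ℚ ℚ.- ι q
    -1ℚ = ℚ.- 1ℚ

  -- Here the base 1 - q and the sign originate: q [c = d] - 1 equals -(1 - q)^[c = d], so an edge
  -- to a vertex of colour c costs a sign and raises counter c by one.
  edgeWeight-shift : ∀ (ms : Vec ℕ q) c d →
    edgeWeight c d ℚ.* y ^ Vec.lookup ms d ≡ -1ℚ ℚ.* y ^ Vec.lookup (ms [ c ]%= suc) d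
  edgeWeight-shift ms c d with c Fin.≟ d
  ... | yes refl = begin
    (ι q ℚ.* 1ℚ ℚ.- 1ℚ) ℚ.* y ^ Vec.lookup ms c
      ≡⟨ solve 2 (λ q t → (q :* con 1ℚ :- con 1ℚ) :* t := (:- con 1ℚ) :* ((con 1ℚ :- q) :* t)) refl (ι q) (y ^ Vec.lookup ms c) ⟩
    -1ℚ ℚ.* y ^ suc (Vec.lookup ms c)
      ≡⟨ cong (λ m → -1ℚ ℚ.* y ^ m) (Vec.lookup∘updateAt c ms) ⟨
    -1ℚ ℚ.* y ^ Vec.lookup (ms [ c ]%= suc) c ∎
  ... | no c≢d = begin
    (ι q ℚ.* 0ℚ ℚ.- 1ℚ) ℚ.* y ^ Vec.lookup ms d
      ≡⟨ solve 2 (λ q t → (q :* con 0ℚ :- con 1ℚ) :* t := (:- con 1ℚ) :* t) refl (ι q) (y ^ Vec.lookup ms d) ⟩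
    -1ℚ ℚ.* y ^ Vec.lookup ms d
      ≡⟨ cong (λ m → -1ℚ ℚ.* y ^ m) (Vec.lookup∘updateAt′ d c (c≢d ∘ sym) ms) ⟨
    -1ℚ ℚ.* y ^ Vec.lookup (ms [ c ]%= suc) d ∎

  countWeight-shift : ∀ {n} (ms : Vec ℕ q) c (θ : Vec (Fin q) n) →
    product {n} (λ v → edgeWeight c (Vec.lookup θ v)) ℚ.* countWeight y ms θ ≡ -1ℚ ^ n ℚ.* countWeight y (ms [ c ]%= suc) θ
  countWeight-shift         ms c []      = refl
  countWeight-shift {suc n} ms c (d ∷ θ) = begin
    edgeWeight c d ℚ.* W ℚ.* (y ^ Vec.lookup ms d ℚ.* countWeight y ms θ)
      ≡⟨ solve 4 (λ a b c d → a :* b :* (c :* d) := a :* c :* (b :* d)) refl (edgeWeight c d) W (y ^ Vec.lookup ms d) (countWeight y ms θ) ⟩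
    edgeWeight c d ℚ.* y ^ Vec.lookup ms d ℚ.* (W ℚ.* countWeight y ms θ)
      ≡⟨ cong₂ ℚ._*_ (edgeWeight-shift ms c d) (countWeight-shift ms c θ) ⟩
    -1ℚ ℚ.* y ^ Vec.lookup ms′ d ℚ.* (-1ℚ ^ n ℚ.* countWeight y ms′ θ)
      ≡⟨ solve 4 (λ a b c d → a :* b :* (c :* d) := a :* c :* (b :* d)) refl -1ℚ (y ^ Vec.lookup ms′ d) (-1ℚ ^ n) (countWeight y ms′ θ) ⟩
    -1ℚ ^ suc n ℚ.* countWeight y ms′ (d ∷ θ) ∎
    where
    ms′ = ms [ c ]%= suc
    W = product {n} (λ v → edgeWeight c (Vec.lookup θ v))

  -- The counters are general so that the first vertex can be moved from θ into `ms`. Its n edges to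
  -- later vertices turn into a sign (-1)^n and an update of the counters; the signs accumulate to
  -- (-1)^(n(n-1)/2), which is the clique weight with base -1.
  completeWeight≡monoWeight : ∀ {n} (ms : Vec ℕ q) (θ : Vec (Fin q) n) →
    completeWeight θ ℚ.* countWeight y ms θ ≡ cliqueWeight -1ℚ n ℚ.* monoWeight y ms θ
  completeWeight≡monoWeight         ms []      = refl
  completeWeight≡monoWeight {suc n} ms (c ∷ θ) = begin
    completeWeight (c ∷ θ) ℚ.* (t ℚ.* countWeight y ms θ)
      ≡⟨ cong (ℚ._* (t ℚ.* countWeight y ms θ)) (completeWeight-∷ c θ) ⟩
    W ℚ.* completeWeight θ ℚ.* (t ℚ.* countWeight y ms θ)
      ≡⟨ solve 4 (λ a b c d → a :* b :* (c :* d) := c :* b :* (a :* d)) refl W (completeWeight θ) t (countWeight y ms θ) ⟩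
    t ℚ.* completeWeight θ ℚ.* (W ℚ.* countWeight y ms θ)
      ≡⟨ cong (t ℚ.* completeWeight θ ℚ.*_) (countWeight-shift ms c θ) ⟩
    t ℚ.* completeWeight θ ℚ.* (-1ℚ ^ n ℚ.* countWeight y ms′ θ)
      ≡⟨ solve 4 (λ a b c d → a :* b :* (c :* d) := c :* a :* (b :* d)) refl t (completeWeight θ) (-1ℚ ^ n) (countWeight y ms′ θ) ⟩
    -1ℚ ^ n ℚ.* t ℚ.* (completeWeight θ ℚ.* countWeight y ms′ θ)
      ≡⟨ cong (-1ℚ ^ n ℚ.* t ℚ.*_) (completeWeight≡monoWeight ms′ θ) ⟩
    -1ℚ ^ n ℚ.* t ℚ.* (cliqueWeight -1ℚ n ℚ.* monoWeight y ms′ θ)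
      ≡⟨ solve 4 (λ a b c d → a :* b :* (c :* d) := a :* c :* (b :* d)) refl (-1ℚ ^ n) t (cliqueWeight -1ℚ n) (monoWeight y ms′ θ) ⟩
    cliqueWeight -1ℚ (suc n) ℚ.* monoWeight y ms (c ∷ θ) ∎
    where
    ms′ = ms [ c ]%= suc
    t = y ^ Vec.lookup ms c
    W = product {n} (λ v → edgeWeight c (Vec.lookup θ v))

  countWeight-replicate : ∀ {n} (θ : Vec (Fin q) n) → countWeight y (Vec.replicate q 0) θ ≡ 1ℚ
  countWeight-replicate []      = refl
  countWeight-replicate (c ∷ θ) = cong₂ (λ m s → y ^ m ℚ.* s) (Vec.lookup-replicate c 0) (countWeight-replicate θ)

  ∑colourings-complete : ∀ n → ∑colourings {q} (Vec.fromList (Graph.edges (complete n))) ≡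
    cliqueWeight -1ℚ n ℚ.* ∑Vec n (monoWeight y (Vec.replicate q 0))
  ∑colourings-complete n = trans (∑Vec-cong n (λ θ → begin
    colouringWeight (Vec.fromList (Graph.edges (complete n))) θ          ≡⟨ colouringWeight-complete n θ ⟩
    completeWeight θ                                                     ≡⟨ ℚ.*-identityʳ _ ⟨
    completeWeight θ ℚ.* 1ℚ                                              ≡⟨ cong (completeWeight θ ℚ.*_) (countWeight-replicate θ) ⟨
    completeWeight θ ℚ.* countWeight y (Vec.replicate q 0) θ             ≡⟨ completeWeight≡monoWeight (Vec.replicate q 0) θ ⟩
    cliqueWeight -1ℚ n ℚ.* monoWeight y (Vec.replicate q 0) θ            ∎))
    (∑Vec-scale n (cliqueWeight -1ℚ n) (monoWeight y (Vec.replicate q 0)))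

flowPoly-isFlowPolynomial : ∀ G → flowPoly _ (Vec.fromList (Graph.edges G)) IsFlowPolynomialOf G
flowPoly-isFlowPolynomial (graph n es) (suc p) = trans (eval-flowPoly p _ (Vec.fromList es)) (sym (#nowhereZeroFlows≡flows p es))

corollary4 : ∀ (n : ℕ) .{{_ : NonZero n}} →
    (∃[ F ] F IsFlowPolynomialOf complete n) ×
    (∀ (F : Poly) → F IsFlowPolynomialOf complete n →
    X ^ₚ n *ₚ F ≈ₚ
    (-ₚ 1ₚ) ^ₚ (n * (n ∸ 1) / 2) *ₚ
    at-z=0 (iterate ∂z
    ((∑ₛ {suc n} (λ i → constₛ (C (1/ toℕ i !) *ₚ (1ₚ -ₚ X) ^ₚ (toℕ i * (toℕ i ∸ 1) / 2)) *ₛ z ^ₛ toℕ i)) ^ˣ)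
    n))
corollary4 n = (flowPoly _ (Vec.fromList (Graph.edges (complete n))) , flowPoly-isFlowPolynomial (complete n)) , identity
  where
  D = at-z=0 (iterate ∂z (cliqueSeries n ^ˣ) n)
  t = n * (n ∸ 1) / 2
  identity : ∀ F → F IsFlowPolynomialOf complete n → X ^ₚ n *ₚ F ≈ₚ (-ₚ 1ₚ) ^ₚ t *ₚ D
  identity F isFlow = eval-positive⇒≈ (X ^ₚ n *ₚ F) ((-ₚ 1ₚ) ^ₚ t *ₚ D) agree
    where
    agree : ∀ p → eval (X ^ₚ n *ₚ F) (ι (suc p)) ≡ eval ((-ₚ 1ₚ) ^ₚ t *ₚ D) (ι (suc p))
    agree p = begin
      eval (X ^ₚ n *ₚ F) r                    ≡⟨ eval-* r (X ^ₚ n) F ⟩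
      eval (X ^ₚ n) r ℚ.* eval F r            ≡⟨ cong₂ ℚ._*_ (trans (eval-^ r X n) (cong (_^ n) (eval-X r))) (trans (isFlow (suc p)) (#nowhereZeroFlows≡flows p es)) ⟩
      r ^ n ℚ.* flows p (Vec.fromList es)     ≡⟨ flows≡∑colourings p _ (Vec.fromList es) ⟩
      ∑colourings (Vec.fromList es)           ≡⟨ ∑colourings-complete n ⟩
      -- This sum of monochromatic weights is the common value: the graph side arrives at it from
      -- above, the derivative of the q-th power from below.
      cliqueWeight (ℚ.- 1ℚ) n ℚ.* ∑Vec n (monoWeight (1ℚ ℚ.- r) (Vec.replicate (suc p) 0))
        ≡⟨ cong₂ ℚ._*_ eval-sign (eval-derivative (suc p) n) ⟨
      eval ((-ₚ 1ₚ) ^ₚ t) r ℚ.* eval D r      ≡⟨ eval-* r ((-ₚ 1ₚ) ^ₚ t) D ⟨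
      eval ((-ₚ 1ₚ) ^ₚ t *ₚ D) r              ∎
      where
      r = ι (suc p)
      es = Graph.edges (complete n)
      eval-sign : eval ((-ₚ 1ₚ) ^ₚ t) r ≡ cliqueWeight (ℚ.- 1ℚ) n
      eval-sign = begin
        eval ((-ₚ 1ₚ) ^ₚ t) r             ≡⟨ eval-^ r (-ₚ 1ₚ) t ⟩
        eval (-ₚ 1ₚ) r ^ t                ≡⟨ cong (_^ t) (trans (eval-neg r 1ₚ) (cong ℚ.-_ (eval-C r 1ℚ))) ⟩
        (ℚ.- 1ℚ) ^ t                      ≡⟨ ^-triangle (ℚ.- 1ℚ) n ⟩
        cliqueWeight (ℚ.- 1ℚ) n           ∎
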